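{- Let $G$ be an $n$-vertex graph with minimum cut value $c$, each of whose edges fails independently with probability $p$. When $p^c<n^{ -4}$ (and in particular when $\mathrm{FAIL}(p)<n^{ -4}$), the sum of the failure probabilities of the weak cuts of $G$ is a $(1+o(1))$-approximation to $\mathrm{FAIL}(p)$; that is, $$\sum_{C\ \text{weak cut of}\ G} p^{|C|} = (1+o(1))\,\mathrm{FAIL}(p)\qquad\text{as } n\to\infty,$$ where $|C|$ denotes the number of edges of the cut $C$.
   Context: Graphs are undirected; parallel edges are allowed; $0<p<1$. A cut is a partition of the vertex set into two nonempty groups; its edges are those with one endpoint in each group, and its value is the number of its edges. $c$ is the smallest value of any cut. A cut fails when all its edges fail, so a cut $C$ has failure probability $p^{|C|}$. $\mathrm{FAIL}(p)$ is the probability that the graph formed by the surviving edges is disconnected. An $\alpha$-minimum cut is a cut of value at most $\alpha c$. Write $p^c=n^{ -(2+\delta)}$. For a target error $\epsilon$, the weak cuts of $G$ are the $\alpha$-minimum cuts with $\alpha=1+2/\delta-(\ln\epsilon)/(\delta\ln n)$. Here $\epsilon=\epsilon(n)$ is any function with $\epsilon(n)\to0$ as $n\to\infty$, and the $o(1)$ is with respect to $n\to\infty$. -}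

module Defs where

open import Algebra.Bundles using (CommutativeRing; Semiring)
import Algebra.Definitions.RawSemiring as RawSemiringDefs
open import Algebra.Structures using (IsCommutativeRing)
open import Data.Bool.Base using (_xor_)
open import Data.Empty using (⊥)
open import Data.Fin.Base using (Fin; zero; suc)
open import Data.Fin.Properties as Fin using (all?)
open import Data.Fin.Subset using (Subset; inside; outside; _∈_; _∉_; Nonempty; ∁; ∣_∣)
open import Data.Fin.Subset.Properties using (_∈?_; nonempty?; drop-there)
open import Data.List.Base as List using (List; []; _∷_; _++_; filter; foldr)
open import Data.Nat.Base as ℕ using (ℕ; zero; suc)
open import Data.Product.Base using (∃; _×_; _,_; proj₁; proj₂)
open import Data.Sum.Base using (_⊎_; inj₁; inj₂)
open import Data.Vec.Base using ([]; _∷_; lookup; tabulate; here; there)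
open import Data.Vec.Functional using (Vector)
open import Function.Base using (_∘_)
open import Level using (0ℓ)
open import Relation.Binary.Construct.Closure.Equivalence as EqC using (EqClosure)
open import Relation.Binary.Construct.Closure.ReflexiveTransitive using (ε; _◅_; _◅◅_)
open import Relation.Binary.Construct.Closure.Symmetric using (fwd; bwd)
import Relation.Binary.Construct.NonStrictToStrict as ToStrict
open import Relation.Binary.Core using (Rel)
open import Relation.Binary.PropositionalEquality using (_≡_; refl; cong)
open import Relation.Binary.Structures using (IsDecTotalOrder)
open import Relation.Nullary using (¬_; Dec; yes; no)
open import Relation.Nullary.Decidable using (map′; ¬?; _×-dec_; _⊎-dec_)
open import Relation.Unary using (Pred; Decidable)

-- The library has no real numbers, so theorems about them quantify over all
-- structures of this kind: Dedekind-complete ordered fields.  Such a field is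
-- unique up to isomorphism.  The theory is the classical one: the order is
-- decidable and every nonempty bounded set has a supremum, so an inhabitant
-- exists under excluded middle (take Cauchy reals; _≈_ is their equality).
record Reals : Set₁ where
  infix  4 _≈_ _≤_
  infixl 6 _+_
  infixl 7 _*_
  infix  8 -_ _⁻¹
  field
    Carrier : Set
    _≈_ _≤_ : Rel Carrier 0ℓ
    _+_ _*_ : Carrier → Carrier → Carrier
    -_      : Carrier → Carrier
    0# 1#   : Carrier

    isCommutativeRing : IsCommutativeRing _≈_ _+_ _*_ -_ 0# 1#

    -- The value of 0# ⁻¹ is unspecified.
    _⁻¹      : Carrier → Carrier
    ⁻¹-cong  : ∀ {x y} → x ≈ y → x ⁻¹ ≈ y ⁻¹
    *-inverseʳ : ∀ {x} → ¬ (x ≈ 0#) → x * x ⁻¹ ≈ 1#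
    0≉1      : ¬ (0# ≈ 1#)

    isDecTotalOrder : IsDecTotalOrder _≈_ _≤_
    +-monoˡ-≤       : ∀ {x y} z → x ≤ y → x + z ≤ y + z
    *-nonNegative   : ∀ {x y} → 0# ≤ x → 0# ≤ y → 0# ≤ x * y

  open ToStrict _≈_ _≤_ public using (_<_)

  field
    -- "s is the supremum" in its approximation form: an upper bound with
    -- elements of the set above every smaller number.
    supremum : (P : Pred Carrier 0ℓ) → ∃ P → (∃ λ b → ∀ x → P x → x ≤ b) →
               ∃ λ s → (∀ x → P x → x ≤ s) ×
                       (∀ y → y < s → ∃ λ x → P x × y < x)

    -- In a complete ordered field exactly one function satisfies exp-+ and
    -- 1+x≤exp, namely the exponential; ln is then determined on positive
    -- numbers (and unspecified elsewhere).
    exp       : Carrier → Carrier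
    exp-cong  : ∀ {x y} → x ≈ y → exp x ≈ exp y
    exp-+     : ∀ x y → exp (x + y) ≈ exp x * exp y
    1+x≤exp   : ∀ x → 1# + x ≤ exp x
    ln        : Carrier → Carrier
    ln-cong   : ∀ {x y} → x ≈ y → ln x ≈ ln y
    exp-ln    : ∀ {x} → 0# < x → exp (ln x) ≈ x

  commutativeRing : CommutativeRing 0ℓ 0ℓ
  commutativeRing = record { isCommutativeRing = isCommutativeRing }

  open IsDecTotalOrder isDecTotalOrder public using (_≤?_)
  open RawSemiringDefs
    (Semiring.rawSemiring (CommutativeRing.semiring commutativeRing)) public
    using (_^_) renaming (_×_ to _·_)

  infixl 6 _-_
  _-_ : Carrier → Carrier → Carrier
  x - y = x + - y

  infixl 7 _/_
  _/_ : Carrier → Carrier → Carrier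
  x / y = x * y ⁻¹

  fromℕ : ℕ → Carrier
  fromℕ n = n · 1#

  -- Real exponent; meaningful for positive base.
  infixr 8 _^ʳ_
  _^ʳ_ : Carrier → Carrier → Carrier
  x ^ʳ y = exp (y * ln x)

  TendsToZero : (ℕ → Carrier) → Set
  TendsToZero f = ∀ η → 0# < η →
    ∃ λ N → ∀ n → N ℕ.≤ n → - η ≤ f n × f n ≤ η

  sumOver : {A : Set} → List A → (A → Carrier) → Carrier
  sumOver xs f = foldr (λ x s → f x + s) 0# xs

allSubsets : ∀ n → List (Subset n)
allSubsets zero    = [] ∷ []
allSubsets (suc n) =
  List.map (outside ∷_) (allSubsets n) ++ List.map (inside ∷_) (allSubsets n)

-- Edges are labelled, so parallel edges are distinct.  The order of the two
-- ends carries no meaning.  Loops are not excluded; they belong to no cut and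
-- do not affect connectivity.
record Graph (n : ℕ) : Set where
  field
    size : ℕ
    ends : Vector (Fin n × Fin n) size

open Graph public

-- A partition into two nonempty groups is unordered; it is represented once,
-- by the group containing vertex zero.
IsCut : ∀ {n} → Subset n → Set
IsCut {zero}  S = ⊥
IsCut {suc n} S = zero ∈ S × Nonempty (∁ S)

isCut? : ∀ {n} → Decidable (IsCut {n})
isCut? {zero}  S = no λ ()
isCut? {suc n} S = (zero ∈? S) ×-dec nonempty? (∁ S)

cuts : ∀ n → List (Subset n)
cuts n = filter isCut? (allSubsets n)

cutEdges : ∀ {n} (G : Graph n) → Subset n → Subset (size G)
cutEdges G S =
  tabulate λ e → lookup S (proj₁ (ends G e)) xor lookup S (proj₂ (ends G e))

cutValue : ∀ {n} → Graph n → Subset n → ℕ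
cutValue G S = ∣ cutEdges G S ∣

IsMinCutValue : ∀ {n} → Graph n → ℕ → Set
IsMinCutValue G c = (∃ λ S → IsCut S × cutValue G S ≡ c) ×
                    (∀ S → IsCut S → c ℕ.≤ cutValue G S)

-- F is the set of failed edges throughout.
Link : ∀ {n m} → Vector (Fin n × Fin n) m → Subset m → Rel (Fin n) 0ℓ
Link es F u v = ∃ λ e → e ∉ F × es e ≡ (u , v)

Connected : ∀ {n} (G : Graph n) → Subset (size G) → Set
Connected G F = ∀ u v → EqClosure (Link (ends G) F) u v

private
  module _ {n m : ℕ} (es : Vector (Fin n × Fin n) (suc m)) (F : Subset m) where

    J : Rel (Fin n) 0ℓ
    J = EqClosure (Link (es ∘ suc) F)

    weaken : ∀ {s u v} → J u v → EqClosure (Link es (s ∷ F)) u v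
    weaken = EqC.map λ { (e , e∉F , eq) → suc e , (λ e∈ → e∉F (drop-there e∈)) , eq }

    strengthen : ∀ {u v} → EqClosure (Link es (inside ∷ F)) u v → J u v
    strengthen = EqC.map λ
      { (zero  , 0∉ , eq) → contra 0∉
      ; (suc e , e∉ , eq) → e , (λ e∈F → e∉ (there e∈F)) , eq
      }
      where
      contra : {A : Set} → zero ∉ (inside ∷ F) → A
      contra 0∉ with () ← 0∉ here

    a b : Fin n
    a = proj₁ (es zero)
    b = proj₂ (es zero)

    J⁺ : Rel (Fin n) 0ℓ
    J⁺ u v = J u v ⊎ (J u a × J b v) ⊎ (J u b × J a v)

    J⁺-sound : ∀ {u v} → J⁺ u v → EqClosure (Link es (outside ∷ F)) u v
    J⁺-sound (inj₁ p)              = weaken p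
    J⁺-sound (inj₂ (inj₁ (p , q))) =
      weaken p ◅◅ fwd (zero , (λ ()) , refl) ◅ weaken q
    J⁺-sound (inj₂ (inj₂ (p , q))) =
      weaken p ◅◅ bwd (zero , (λ ()) , refl) ◅ weaken q

    J⁺-prepend : ∀ {u w v} → J u w → J⁺ w v → J⁺ u v
    J⁺-prepend r (inj₁ p)              = inj₁ (r ◅◅ p)
    J⁺-prepend r (inj₂ (inj₁ (p , q))) = inj₂ (inj₁ (r ◅◅ p , q))
    J⁺-prepend r (inj₂ (inj₂ (p , q))) = inj₂ (inj₂ (r ◅◅ p , q))

    J⁺-complete : ∀ {u v} → EqClosure (Link es (outside ∷ F)) u v → J⁺ u v
    J⁺-complete ε = inj₁ ε
    J⁺-complete (fwd (suc e , e∉ , eq) ◅ p) =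
      J⁺-prepend (fwd (e , (λ e∈ → e∉ (there e∈)) , eq) ◅ ε) (J⁺-complete p)
    J⁺-complete (bwd (suc e , e∉ , eq) ◅ p) =
      J⁺-prepend (bwd (e , (λ e∈ → e∉ (there e∈)) , eq) ◅ ε) (J⁺-complete p)
    J⁺-complete {u} {v} (fwd (zero , _ , eq) ◅ p)
      with refl ← cong proj₁ eq | refl ← cong proj₂ eq with J⁺-complete p
    ... | inj₁ q              = inj₂ (inj₁ (ε , q))
    ... | inj₂ (inj₁ (_ , q)) = inj₂ (inj₁ (ε , q))
    ... | inj₂ (inj₂ (_ , q)) = inj₁ q
    J⁺-complete {u} {v} (bwd (zero , _ , eq) ◅ p)
      with refl ← cong proj₁ eq | refl ← cong proj₂ eq with J⁺-complete p
    ... | inj₁ q              = inj₂ (inj₂ (ε , q))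
    ... | inj₂ (inj₁ (_ , q)) = inj₁ q
    ... | inj₂ (inj₂ (_ , q)) = inj₂ (inj₂ (ε , q))

joined? : ∀ {n m} (es : Vector (Fin n × Fin n) m) (F : Subset m) →
          ∀ u v → Dec (EqClosure (Link es F) u v)
joined? es [] u v = map′ (λ { refl → ε }) noEdges (u Fin.≟ v)
  where
  noEdges : ∀ {u v} → EqClosure (Link es []) u v → u ≡ v
  noEdges ε                  = refl
  noEdges (fwd (() , _) ◅ _)
  noEdges (bwd (() , _) ◅ _)
joined? es (inside ∷ F) u v =
  map′ (weaken es F) (strengthen es F) (joined? (es ∘ suc) F u v)
joined? es (outside ∷ F) u v = map′ (J⁺-sound es F) (J⁺-complete es F)
  (j? u v ⊎-dec ((j? u (a es F) ×-dec j? (b es F) v) ⊎-dec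
                 (j? u (b es F) ×-dec j? (a es F) v)))
  where j? = joined? (es ∘ suc) F

connected? : ∀ {n} (G : Graph n) → Decidable (Connected G)
connected? G F = all? λ u → all? λ v → joined? (ends G) F u v

module Reliability (ℝ : Reals) where
  open Reals ℝ

  -- Probability that the set of failed edges satisfies E, when each of m edges
  -- fails independently with probability p.
  Pr : ∀ {m} → Carrier → {E : Pred (Subset m) 0ℓ} → Decidable E → Carrier
  Pr {m} p E? =
    sumOver (filter E? (allSubsets m)) λ F → p ^ ∣ F ∣ * (1# - p) ^ ∣ ∁ F ∣

  FAIL : ∀ {n} → Graph n → Carrier → Carrier
  FAIL G p = Pr p (λ F → ¬? (connected? G F))

  -- ε₀ is the value ε(n) of the target error.
  weakα : ℕ → (δ ε₀ : Carrier) → Carrier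
  weakα n δ ε₀ = 1# + fromℕ 2 / δ - ln ε₀ / (δ * ln (fromℕ n))

  IsαMinimum : ∀ {n} → Graph n → (c : ℕ) (α : Carrier) → Pred (Subset n) 0ℓ
  IsαMinimum G c α S = fromℕ (cutValue G S) ≤ α * fromℕ c

  isαMinimum? : ∀ {n} (G : Graph n) c α → Decidable (IsαMinimum G c α)
  isαMinimum? G c α S = fromℕ (cutValue G S) ≤? α * fromℕ c

  weakCuts : ∀ {n} → Graph n → (c : ℕ) (δ ε₀ : Carrier) → List (Subset n)
  weakCuts {n} G c δ ε₀ = filter (isαMinimum? G c (weakα n δ ε₀)) (cuts n)

  weakCutSum : ∀ {n} → Graph n → (c : ℕ) (δ ε₀ p : Carrier) → Carrier
  weakCutSum G c δ ε₀ p = sumOver (weakCuts G c δ ε₀) λ S → p ^ cutValue G S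

{-# OPTIONS --safe #-}
module Submission where

open import Defs
open import Algebra.Bundles using (CommutativeRing)
import Algebra.Solver.Ring
open import Algebra.Solver.Ring.AlmostCommutativeRing
  using (fromCommutativeRing; _-Raw-AlmostCommutative⟶_)
open import Data.Bool.Base using (Bool; true; false; if_then_else_; _xor_; not; _∨_)
open import Data.Bool.Properties as Bool
  using (xor-same; xor-comm; xor-annihilates-not; not-distribˡ-xor)
open import Data.Empty using (⊥-elim)
open import Data.Fin.Base using (Fin; zero; suc; punchIn; punchOut)
open import Data.Fin.Properties as Fin using (any?; punchIn-punchOut; punchInᵢ≢i)
open import Data.Fin.Subset using (Subset; inside; outside; ∣_∣; _∪_; ∁; _∈_; _∉_; _⊆_)
open import Data.Fin.Subset.Properties
  using ( _⊆?_; _∈?_; x∉p⇒x∈∁p; x∈∁p⇒x∉p; x∈p⇒x∉∁p; p⊆p∪q; q⊆p∪q; x∈p∪q⁻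
        ; ∪-idem; ∣p∣≤n )
open import Data.Integer.Base as ℤ using (ℤ; +_; -[1+_])
import Data.Integer.Properties as ℤ
open import Data.List.Base as List using (List; []; _∷_; _++_; filter; allFin)
open import Data.List.Membership.Propositional using () renaming (_∈_ to _∈ₗ_)
open import Data.List.Membership.Propositional.Properties using (∈-map⁺; ∈-++⁺ˡ; ∈-++⁺ʳ)
open import Data.List.Relation.Unary.Any using (here; there)
open import Data.Maybe.Base using (just; nothing)
open import Data.Nat.Base as ℕ using (ℕ; zero; suc)
import Data.Nat.Properties as ℕ
open import Data.Product.Base using (∃; _×_; _,_; proj₁; proj₂)
open import Data.Sign.Base as Sign using ()
open import Data.Sum.Base using (_⊎_; inj₁; inj₂; [_,_]′)
open import Data.Vec.Base as Vec using ([]; _∷_; lookup; tabulate; zipWith; insertAt)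
open import Data.Vec.Properties
  using ( ≡-dec; insertAt-lookup; insertAt-punchIn; lookup∘tabulate; tabulate∘lookup
        ; tabulate-cong; lookup-map; lookup-zipWith; []=⇒lookup; lookup⇒[]= )
open import Function.Base using (_∘_)
open import Level using (0ℓ)
open import Relation.Binary.Bundles using (Poset)
open import Relation.Binary.Construct.Closure.Equivalence as EqC using (EqClosure)
open import Relation.Binary.Construct.Closure.ReflexiveTransitive as Star using (_◅_; _◅◅_)
open import Relation.Binary.Construct.Closure.Symmetric using (fwd; bwd)
open import Relation.Binary.Definitions using (DecidableEquality)
open import Relation.Binary.PropositionalEquality as ≡ using (_≡_; _≢_)
open import Relation.Binary.Structures using (IsDecTotalOrder)
open import Relation.Nullary using (¬_; Dec; yes; no; does)
open import Relation.Nullary.Decidable using (¬?; dec-true; dec-false; decidable-stable)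
open import Relation.Unary using (Pred; Decidable)

-- Let x_C = |C| and write p = exp(-(2+δ)t) with tc = ln n =: ℓ, so that δ > 2.
--
-- Cut counting.  Contract edges at random: in each round each edge is contracted
-- with probability 2κ.  A pair of cuts (S,T) whose union has x edges survives N rounds
-- with probability (1-2κx)^N.  A graph on k vertices with minimum cut c has at least
-- kc/2 edges, so by Bernoulli's inequality and induction on N, summing over all
-- pairs of subsets gives at most 4(1+3(1-κc)^N)^k.  For κ ≈ t/N and N large this says that
-- the sum of exp(-2tx) over all pairs is bounded by the absolute constant
-- K = 4exp(3e).
--
-- Strong cuts.  If C is not weak then p^x_C ≤ ε p^c exp(-2t x_C), so these cuts contribute at
-- most Kε p^c ≤ Kε FAIL, while FAIL is at most the sum σ of p^x_C over all cuts.
--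
-- Pairs of cuts.  Conversely σ - FAIL is at most the sum of p^s over pairs of distinct
-- cuts, where s is the size of the union.  Here 2s = x + y + z, with z the value of the
-- symmetric difference, and as x, y, z ≥ c and δ ≥ 2, the quantity exp(-2(1+δ)ts) is at
-- most 1/n times the product of the failure probabilities of the two smaller ones of the
-- three cuts.  By AM-GM, 2p^s ≤ θ exp(-2ts) + exp(-2(1+δ)ts)/θ, so the pairs contribute at
-- most (θK + 3σ²/(θn))/2, which is o(σ) for θ a small multiple of σ.

-- A ring solver with integer coefficients.

module IntegerCoefficients {c ℓ} (R : CommutativeRing c ℓ) where
  open CommutativeRing R
  open import Algebra.Properties.Semiring.Mult semiring
    using (×-homo-+; ×1-homo-*) renaming (_×_ to _·_)
  open import Algebra.Properties.Ring ring
    using (-0#≈0#; -‿distribˡ-*; -‿distribʳ-*; -‿involutive)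
  open import Algebra.Properties.AbelianGroup +-abelianGroup using (⁻¹-∙-comm)
  open import Relation.Binary.Reasoning.Setoid setoid

  -- Chosen so that con 0 and con 1 denote 0# and 1#, while con n for n ≥ 2
  -- denotes n · 1#.
  embed : ℕ → Carrier
  embed 1 = 1#
  embed n = n · 1#

  embed≈ : ∀ n → embed n ≈ n · 1#
  embed≈ 0             = refl
  embed≈ 1             = sym (+-identityʳ 1#)
  embed≈ (suc (suc n)) = refl

  ⟦_⟧ : ℤ → Carrier
  ⟦ + n      ⟧ = embed n
  ⟦ -[1+ n ] ⟧ = - (suc n · 1#)

  ⊖-homo : ∀ m n → ⟦ m ℤ.⊖ n ⟧ ≈ m · 1# - n · 1#
  ⊖-homo m zero = begin
    embed m         ≈⟨ embed≈ m ⟩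
    m · 1#          ≈⟨ +-identityʳ _ ⟨
    m · 1# + 0#     ≈⟨ +-congˡ -0#≈0# ⟨
    m · 1# - 0#     ∎
  ⊖-homo zero (suc n) = sym (+-identityˡ _)
  ⊖-homo (suc m) (suc n) = begin
    ⟦ suc m ℤ.⊖ suc n ⟧                   ≡⟨ ≡.cong ⟦_⟧ (ℤ.[1+m]⊖[1+n]≡m⊖n m n) ⟩
    ⟦ m ℤ.⊖ n ⟧                           ≈⟨ ⊖-homo m n ⟩
    m · 1# - n · 1#                       ≈⟨ +-congʳ (+-identityʳ _) ⟨
    (m · 1# + 0#) - n · 1#                ≈⟨ +-congʳ (+-congˡ (-‿inverseʳ 1#)) ⟨
    (m · 1# + (1# - 1#)) - n · 1#         ≈⟨ +-congʳ (+-assoc _ _ _) ⟨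
    (m · 1# + 1# - 1#) - n · 1#           ≈⟨ +-congʳ (+-congʳ (+-comm _ _)) ⟩
    (suc m · 1# - 1#) - n · 1#            ≈⟨ +-assoc _ _ _ ⟩
    suc m · 1# + (- 1# - n · 1#)          ≈⟨ +-congˡ (⁻¹-∙-comm _ _) ⟩
    suc m · 1# - suc n · 1#               ∎

  +-homo : ∀ i j → ⟦ i ℤ.+ j ⟧ ≈ ⟦ i ⟧ + ⟦ j ⟧
  +-homo (+ m) (+ n) = begin
    embed (m ℕ.+ n)     ≈⟨ embed≈ (m ℕ.+ n) ⟩
    (m ℕ.+ n) · 1#      ≈⟨ ×-homo-+ 1# m n ⟩
    m · 1# + n · 1#     ≈⟨ +-cong (embed≈ m) (embed≈ n) ⟨
    embed m + embed n   ∎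
  +-homo (+ m) -[1+ n ] = trans (⊖-homo m (suc n)) (+-congʳ (sym (embed≈ m)))
  +-homo -[1+ m ] (+ n) =
    trans (⊖-homo n (suc m)) (trans (+-comm _ _) (+-congˡ (sym (embed≈ n))))
  +-homo -[1+ m ] -[1+ n ] = begin
    - (suc (suc (m ℕ.+ n)) · 1#)      ≡⟨ ≡.cong (λ k → - (suc k · 1#)) (ℕ.+-suc m n) ⟨
    - ((suc m ℕ.+ suc n) · 1#)        ≈⟨ -‿cong (×-homo-+ 1# (suc m) (suc n)) ⟩
    - (suc m · 1# + suc n · 1#)       ≈⟨ ⁻¹-∙-comm _ _ ⟨
    - (suc m · 1#) - suc n · 1#       ∎

  ◃-homo : ∀ n → ⟦ Sign.- ℤ.◃ n ⟧ ≈ - (n · 1#)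
  ◃-homo zero    = sym -0#≈0#
  ◃-homo (suc n) = refl

  *-homo : ∀ i j → ⟦ i ℤ.* j ⟧ ≈ ⟦ i ⟧ * ⟦ j ⟧
  *-homo (+ m) (+ n) = begin
    ⟦ Sign.+ ℤ.◃ (m ℕ.* n) ⟧ ≡⟨ ≡.cong ⟦_⟧ (ℤ.+◃n≡+n (m ℕ.* n)) ⟩
    embed (m ℕ.* n)     ≈⟨ embed≈ (m ℕ.* n) ⟩
    (m ℕ.* n) · 1#      ≈⟨ ×1-homo-* m n ⟩
    m · 1# * n · 1#     ≈⟨ *-cong (embed≈ m) (embed≈ n) ⟨
    embed m * embed n   ∎
  *-homo (+ m) -[1+ n ] = begin
    ⟦ Sign.- ℤ.◃ (m ℕ.* suc n) ⟧   ≈⟨ ◃-homo (m ℕ.* suc n) ⟩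
    - ((m ℕ.* suc n) · 1#)         ≈⟨ -‿cong (×1-homo-* m (suc n)) ⟩
    - (m · 1# * suc n · 1#)        ≈⟨ -‿distribʳ-* _ _ ⟩
    m · 1# * - (suc n · 1#)        ≈⟨ *-congʳ (embed≈ m) ⟨
    embed m * - (suc n · 1#)       ∎
  *-homo -[1+ m ] (+ n) = begin
    ⟦ Sign.- ℤ.◃ (suc m ℕ.* n) ⟧   ≈⟨ ◃-homo (suc m ℕ.* n) ⟩
    - ((suc m ℕ.* n) · 1#)         ≈⟨ -‿cong (×1-homo-* (suc m) n) ⟩
    - (suc m · 1# * n · 1#)        ≈⟨ -‿distribˡ-* _ _ ⟩
    - (suc m · 1#) * n · 1#        ≈⟨ *-congˡ (embed≈ n) ⟨
    - (suc m · 1#) * embed n       ∎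
  *-homo -[1+ m ] -[1+ n ] = begin
    embed (suc m ℕ.* suc n)              ≈⟨ embed≈ (suc m ℕ.* suc n) ⟩
    (suc m ℕ.* suc n) · 1#               ≈⟨ ×1-homo-* (suc m) (suc n) ⟩
    suc m · 1# * suc n · 1#              ≈⟨ -‿involutive _ ⟨
    - - (suc m · 1# * suc n · 1#)        ≈⟨ -‿cong (-‿distribˡ-* _ _) ⟩
    - (- (suc m · 1#) * suc n · 1#)      ≈⟨ -‿distribʳ-* _ _ ⟩
    - (suc m · 1#) * - (suc n · 1#)      ∎

  -‿homo : ∀ i → ⟦ ℤ.- i ⟧ ≈ - ⟦ i ⟧
  -‿homo (+ zero)  = sym -0#≈0#
  -‿homo (+ suc n) = -‿cong (sym (embed≈ (suc n)))
  -‿homo -[1+ n ]  = trans (embed≈ (suc n)) (sym (-‿involutive _))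

  homomorphism : ℤ.+-*-rawRing -Raw-AlmostCommutative⟶ fromCommutativeRing R
  homomorphism = record
    { ⟦_⟧    = ⟦_⟧
    ; +-homo = +-homo
    ; *-homo = *-homo
    ; -‿homo = -‿homo
    ; 0-homo = refl
    ; 1-homo = refl
    }

  -- A negative answer claims nothing: distinct integers may have equal images in a commutative
  -- ring, and the solver needs only sound positive answers.
  dec : ∀ i j → _
  dec i j with i ℤ.≟ j
  ... | yes eq = just (reflexive (≡.cong ⟦_⟧ eq))
  ... | no _   = nothing

  open Algebra.Solver.Ring ℤ.+-*-rawRing (fromCommutativeRing R) homomorphism dec public
    using (solve; _:=_; _:+_; _:*_; _:-_; :-_; con)

-- Ordered-field arithmetic, the exponential function and Bernoulli's inequality.

module OrderedField (ℝ : Reals) where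
  open Reals ℝ
  open CommutativeRing commutativeRing public
    using ( setoid; +-cong; +-congˡ; +-congʳ; *-cong; *-congˡ; *-congʳ; -‿cong
          ; +-identityˡ; +-identityʳ; *-identityˡ; *-identityʳ; +-comm; *-comm
          ; +-assoc; *-assoc; zeroˡ; zeroʳ; distribˡ; distribʳ; -‿inverseʳ; -‿inverseˡ)
    renaming (refl to ≈-refl; sym to ≈-sym; trans to ≈-trans; reflexive to ≈-reflexive)
  open IsDecTotalOrder isDecTotalOrder public
    using (_≟_; total; antisym)
    renaming (refl to ≤-refl; trans to ≤-trans; reflexive to ≤-reflexive)
  open IntegerCoefficients commutativeRing public
    using (solve; _:=_; _:+_; _:*_; _:-_; :-_; con)
  open import Algebra.Properties.Semiring.Exp (CommutativeRing.semiring commutativeRing) public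
    using (^-congˡ)

  poset : Poset _ _ _
  poset = record { isPartialOrder = IsDecTotalOrder.isPartialOrder isDecTotalOrder }

  open import Relation.Binary.Reasoning.PartialOrder poset public

  -- Reduces an inequality to a nonnegative slack `d` and an equation, which the ring solver can
  -- then check.
  ≤-by : ∀ {x y} d → 0# ≤ d → x + d ≈ y → x ≤ y
  ≤-by {x} {y} d 0≤d eq = begin
    x         ≈⟨ +-identityˡ x ⟨
    0# + x    ≤⟨ +-monoˡ-≤ x 0≤d ⟩
    d + x     ≈⟨ +-comm d x ⟩
    x + d     ≈⟨ eq ⟩
    y         ∎

  0≤-diff : ∀ {x y} → x ≤ y → 0# ≤ y - x
  0≤-diff {x} {y} x≤y = begin
    0#      ≈⟨ -‿inverseʳ x ⟨
    x - x   ≤⟨ +-monoˡ-≤ (- x) x≤y ⟩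
    y - x   ∎

  +-mono-≤ : ∀ {x y u v} → x ≤ y → u ≤ v → x + u ≤ y + v
  +-mono-≤ {x} {y} {u} {v} x≤y u≤v = begin
    x + u  ≤⟨ +-monoˡ-≤ u x≤y ⟩
    y + u  ≈⟨ +-comm y u ⟩
    u + y  ≤⟨ +-monoˡ-≤ y u≤v ⟩
    v + y  ≈⟨ +-comm v y ⟩
    y + v  ∎

  +-monoʳ-≤ : ∀ {u v} x → u ≤ v → x + u ≤ x + v
  +-monoʳ-≤ x = +-mono-≤ ≤-refl

  +-nonNegative : ∀ {x y} → 0# ≤ x → 0# ≤ y → 0# ≤ x + y
  +-nonNegative {x} {y} 0≤x 0≤y = begin
    0#       ≈⟨ +-identityʳ 0# ⟨
    0# + 0#  ≤⟨ +-mono-≤ 0≤x 0≤y ⟩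
    x + y    ∎

  *-monoˡ-≤ : ∀ {x y z} → 0# ≤ z → x ≤ y → z * x ≤ z * y
  *-monoˡ-≤ {x} {y} {z} 0≤z x≤y = ≤-by (z * (y - x)) (*-nonNegative 0≤z (0≤-diff x≤y))
    (solve 3 (λ x y z → z :* x :+ z :* (y :- x) := z :* y) ≈-refl x y z)

  *-monoʳ-≤ : ∀ {x y z} → 0# ≤ z → x ≤ y → x * z ≤ y * z
  *-monoʳ-≤ {x} {y} {z} 0≤z x≤y = begin
    x * z  ≈⟨ *-comm x z ⟩
    z * x  ≤⟨ *-monoˡ-≤ 0≤z x≤y ⟩
    z * y  ≈⟨ *-comm z y ⟩
    y * z  ∎

  *-mono-≤ : ∀ {x y u v} → 0# ≤ x → 0# ≤ v → x ≤ y → u ≤ v → x * u ≤ y * v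
  *-mono-≤ 0≤x 0≤v x≤y u≤v = ≤-trans (*-monoˡ-≤ 0≤x u≤v) (*-monoʳ-≤ 0≤v x≤y)

  neg-antimono-≤ : ∀ {x y} → x ≤ y → - y ≤ - x
  neg-antimono-≤ {x} {y} x≤y = ≤-by (y - x) (0≤-diff x≤y)
    (solve 2 (λ x y → :- y :+ (y :- x) := :- x) ≈-refl x y)

  ≰⇒≥ : ∀ {x y} → ¬ (x ≤ y) → y ≤ x
  ≰⇒≥ {x} {y} x≰y with total x y
  ... | inj₁ x≤y = ⊥-elim (x≰y x≤y)
  ... | inj₂ y≤x = y≤x

  ≰⇒> : ∀ {x y} → ¬ (x ≤ y) → y < x
  ≰⇒> x≰y = ≰⇒≥ x≰y , λ y≈x → x≰y (≤-reflexive (≈-sym y≈x))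

  <⇒≱ : ∀ {x y} → x < y → ¬ (y ≤ x)
  <⇒≱ (x≤y , x≉y) y≤x = x≉y (antisym x≤y y≤x)

  0≤x*x : ∀ x → 0# ≤ x * x
  0≤x*x x with total 0# x
  ... | inj₁ 0≤x = *-nonNegative 0≤x 0≤x
  ... | inj₂ x≤0 = begin
    0#             ≤⟨ *-nonNegative 0≤-x 0≤-x ⟩
    - x * - x      ≈⟨ solve 1 (λ x → :- x :* :- x := x :* x) ≈-refl x ⟩
    x * x          ∎
    where
    0≤-x : 0# ≤ - x
    0≤-x = ≤-trans (0≤-diff x≤0) (≤-reflexive (+-identityˡ (- x)))

  0≤1 : 0# ≤ 1#
  0≤1 = ≤-trans (0≤x*x 1#) (≤-reflexive (*-identityˡ 1#))

  0<1 : 0# < 1#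
  0<1 = 0≤1 , 0≉1

  0<⇒≉0 : ∀ {x} → 0# < x → ¬ (x ≈ 0#)
  0<⇒≉0 (_ , 0≉x) x≈0 = 0≉x (≈-sym x≈0)

  <⇒≤ : ∀ {x y} → x < y → x ≤ y
  <⇒≤ = proj₁

  *-inverseˡ : ∀ {x} → 0# < x → x ⁻¹ * x ≈ 1#
  *-inverseˡ {x} 0<x = ≈-trans (*-comm _ _) (*-inverseʳ (0<⇒≉0 0<x))

  -- If `x ≤ y` failed, totality would give `y ≤ x`, so that `z * x` and `z * y` coincide;
  -- multiplying by `z ⁻¹` then identifies `x` and `y`.
  *-cancelˡ-≤ : ∀ {x y z} → 0# < z → z * x ≤ z * y → x ≤ y
  *-cancelˡ-≤ {x} {y} {z} 0<z zx≤zy with x ≤? y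
  ... | yes x≤y = x≤y
  ... | no  x≰y = ≤-reflexive (begin-equality
    x               ≈⟨ *-identityˡ x ⟨
    1# * x          ≈⟨ *-congʳ (*-inverseˡ 0<z) ⟨
    z ⁻¹ * z * x    ≈⟨ *-assoc _ _ _ ⟩
    z ⁻¹ * (z * x)  ≈⟨ *-congˡ (antisym zx≤zy (*-monoˡ-≤ (<⇒≤ 0<z) (≰⇒≥ x≰y))) ⟩
    z ⁻¹ * (z * y)  ≈⟨ *-assoc _ _ _ ⟨
    z ⁻¹ * z * y    ≈⟨ *-congʳ (*-inverseˡ 0<z) ⟩
    1# * y          ≈⟨ *-identityˡ y ⟩
    y               ∎)

  *-positive : ∀ {x y} → 0# < x → 0# < y → 0# < x * y
  *-positive {x} {y} 0<x 0<y = ≰⇒> λ xy≤0 → <⇒≱ 0<y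
    (*-cancelˡ-≤ 0<x (≤-trans xy≤0 (≤-reflexive (≈-sym (zeroʳ x)))))

  ⁻¹-positive : ∀ {x} → 0# < x → 0# < x ⁻¹
  ⁻¹-positive {x} 0<x = ≰⇒> λ x⁻¹≤0 → <⇒≱ 0<1 (begin
    1#        ≈⟨ *-inverseʳ (0<⇒≉0 0<x) ⟨
    x * x ⁻¹  ≤⟨ *-monoˡ-≤ (<⇒≤ 0<x) x⁻¹≤0 ⟩
    x * 0#    ≈⟨ zeroʳ x ⟩
    0#        ∎)

  /-cancelʳ : ∀ x {y} → 0# < y → x / y * y ≈ x
  /-cancelʳ x {y} 0<y = begin-equality
    x / y * y        ≈⟨ *-assoc _ _ _ ⟩
    x * (y ⁻¹ * y)   ≈⟨ *-congˡ (*-inverseˡ 0<y) ⟩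
    x * 1#           ≈⟨ *-identityʳ x ⟩
    x                ∎

  +-positive : ∀ {x y} → 0# < x → 0# ≤ y → 0# < x + y
  +-positive {x} {y} 0<x 0≤y = ≰⇒> λ x+y≤0 → <⇒≱ 0<x (begin
    x        ≈⟨ +-identityʳ x ⟨
    x + 0#   ≤⟨ +-monoʳ-≤ x 0≤y ⟩
    x + y    ≤⟨ x+y≤0 ⟩
    0#       ∎)

  0≤fromℕ : ∀ n → 0# ≤ fromℕ n
  0≤fromℕ zero    = ≤-refl
  0≤fromℕ (suc n) = +-nonNegative 0≤1 (0≤fromℕ n)

  0<fromℕ : ∀ n → 0# < fromℕ (suc n)
  0<fromℕ n = +-positive 0<1 (0≤fromℕ n)

  fromℕ-mono : ∀ {m n} → m ℕ.≤ n → fromℕ m ≤ fromℕ n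
  fromℕ-mono {n = n} ℕ.z≤n = 0≤fromℕ n
  fromℕ-mono (ℕ.s≤s m≤n)   = +-monoʳ-≤ 1# (fromℕ-mono m≤n)

  0<2 : 0# < fromℕ 2
  0<2 = 0<fromℕ 1

  archimedean : ∀ x → ∃ λ n → x ≤ fromℕ n
  archimedean x with x ≤? 0#
  ... | yes x≤0 = 0 , x≤0
  ... | no  x≰0 = decide
    where
    -- If x bounded every natural number, so would sup - 1.
    P : Carrier → Set
    P y = ∃ λ n → (y ≈ fromℕ n) × (∀ k → k ℕ.≤ n → fromℕ k ≤ x)
    sup = supremum P (0# , 0 , ≈-refl , λ { _ ℕ.z≤n → ≰⇒≥ x≰0 })
            (x , λ { y (n , y≈n , below) → ≤-trans (≤-reflexive y≈n) (below n ℕ.≤-refl) })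
    s = proj₁ sup
    s-1<s : s - 1# < s
    s-1<s = ≰⇒> λ s≤s-1 → <⇒≱ 0<1 (begin
      1#              ≈⟨ solve 1 (λ s → con (+ 1) := s :+ (con (+ 1) :- s)) ≈-refl s ⟩
      s + (1# - s)    ≤⟨ +-monoˡ-≤ _ s≤s-1 ⟩
      s - 1# + (1# - s) ≈⟨ solve 1 (λ s → s :- con (+ 1) :+ (con (+ 1) :- s) := con (+ 0)) ≈-refl s ⟩
      0#              ∎)
    decide : ∃ λ n → x ≤ fromℕ n
    decide with proj₂ (proj₂ sup) (s - 1#) s-1<s
    ... | y , (n , y≈n , below) , s-1<y with x ≤? fromℕ (suc n)
    ...   | yes x≤ = suc n , x≤
    -- Now `fromℕ (suc n)` also lies in `P`, hence is at most `s`, and `y ≈ fromℕ n` is at most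
    -- `s - 1#`.
    ...   | no  x≰ = ⊥-elim (<⇒≱ s-1<y (begin
      y                    ≈⟨ y≈n ⟩
      fromℕ n              ≈⟨ solve 1 (λ n → n := con (+ 1) :+ n :- con (+ 1)) ≈-refl (fromℕ n) ⟩
      fromℕ (suc n) - 1#   ≤⟨ +-monoˡ-≤ _ (proj₁ (proj₂ sup) _ (suc n , ≈-refl , below′)) ⟩
      s - 1#               ∎))
      where
      below′ : ∀ k → k ℕ.≤ suc n → fromℕ k ≤ x
      below′ k k≤ with ℕ.m≤n⇒m<n∨m≡n k≤
      ... | inj₁ (ℕ.s≤s k≤n) = below k k≤n
      ... | inj₂ ≡.refl      = ≰⇒≥ x≰

  -- By `exp-+` the value is idempotent, and `1+x≤exp` makes it positive, so it can be cancelled.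
  exp-0 : exp 0# ≈ 1#
  exp-0 = begin-equality
    exp 0#                    ≈⟨ *-identityˡ _ ⟨
    1# * exp 0#               ≈⟨ *-congʳ (*-inverseˡ 0<exp0) ⟨
    exp 0# ⁻¹ * exp 0# * exp 0#   ≈⟨ *-assoc _ _ _ ⟩
    exp 0# ⁻¹ * (exp 0# * exp 0#) ≈⟨ *-congˡ (exp-+ 0# 0#) ⟨
    exp 0# ⁻¹ * exp (0# + 0#) ≈⟨ *-congˡ (exp-cong (+-identityˡ 0#)) ⟩
    exp 0# ⁻¹ * exp 0#        ≈⟨ *-inverseˡ 0<exp0 ⟩
    1#                        ∎
    where
    0<exp0 : 0# < exp 0#
    0<exp0 = begin-strict
      0#        <⟨ 0<1 ⟩
      1#        ≈⟨ +-identityʳ 1# ⟨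
      1# + 0#   ≤⟨ 1+x≤exp 0# ⟩
      exp 0#    ∎

  exp-inverse : ∀ x → exp (- x) * exp x ≈ 1#
  exp-inverse x = begin-equality
    exp (- x) * exp x  ≈⟨ exp-+ _ _ ⟨
    exp (- x + x)      ≈⟨ exp-cong (-‿inverseˡ x) ⟩
    exp 0#             ≈⟨ exp-0 ⟩
    1#                 ∎

  1≤exp : ∀ {x} → 0# ≤ x → 1# ≤ exp x
  1≤exp {x} 0≤x = ≤-trans (≤-by x 0≤x ≈-refl) (1+x≤exp x)

  -- For `x ≤ 0#` the factor `exp (- x)` is nonnegative and its product with `exp x` is 1, so
  -- `exp x` cannot be nonpositive.
  0<exp : ∀ x → 0# < exp x
  0<exp x with total 0# x
  ... | inj₁ 0≤x = begin-strict
    0#     <⟨ 0<1 ⟩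
    1#     ≤⟨ 1≤exp 0≤x ⟩
    exp x  ∎
  ... | inj₂ x≤0 = ≰⇒> λ exp≤0 → <⇒≱ 0<1 (begin
    1#                  ≈⟨ exp-inverse x ⟨
    exp (- x) * exp x   ≤⟨ *-monoˡ-≤ 0≤exp-x exp≤0 ⟩
    exp (- x) * 0#      ≈⟨ zeroʳ _ ⟩
    0#                  ∎)
    where
    0≤exp-x : 0# ≤ exp (- x)
    0≤exp-x = ≤-trans 0≤1 (1≤exp (≤-trans (0≤-diff x≤0) (≤-reflexive (+-identityˡ _))))

  0≤exp : ∀ x → 0# ≤ exp x
  0≤exp x = <⇒≤ (0<exp x)

  exp-mono : ∀ {x y} → x ≤ y → exp x ≤ exp y
  exp-mono {x} {y} x≤y = begin
    exp x                ≈⟨ *-identityʳ _ ⟨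
    exp x * 1#           ≤⟨ *-monoˡ-≤ (0≤exp x) (1≤exp (0≤-diff x≤y)) ⟩
    exp x * exp (y - x)  ≈⟨ exp-+ _ _ ⟨
    exp (x + (y - x))    ≈⟨ exp-cong (solve 2 (λ x y → x :+ (y :- x) := y) ≈-refl x y) ⟩
    exp y                ∎

  -- Strictness comes from `1+x≤exp` at `y - x`: were `exp y ≤ exp x`, cancelling `exp x` would give
  -- `1# + (y - x) ≤ 1#`.
  exp-mono-< : ∀ {x y} → x < y → exp x < exp y
  exp-mono-< {x} {y} x<y = ≰⇒> λ expy≤expx → <⇒≱ x<y (begin
    y                  ≈⟨ solve 2 (λ x y → y := con (+ 1) :+ (y :- x) :+ (x :- con (+ 1))) ≈-refl x y ⟩
    1# + (y - x) + (x - 1#)   ≤⟨ +-monoˡ-≤ _ (*-cancelˡ-≤ (0<exp x) (begin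
       exp x * (1# + (y - x))  ≤⟨ *-monoˡ-≤ (0≤exp x) (1+x≤exp _) ⟩
       exp x * exp (y - x)     ≈⟨ exp-+ _ _ ⟨
       exp (x + (y - x))       ≈⟨ exp-cong (solve 2 (λ x y → x :+ (y :- x) := y) ≈-refl x y) ⟩
       exp y                   ≤⟨ expy≤expx ⟩
       exp x                   ≈⟨ *-identityʳ _ ⟨
       exp x * 1#              ∎)) ⟩
    1# + (x - 1#)             ≈⟨ solve 1 (λ x → con (+ 1) :+ (x :- con (+ 1)) := x) ≈-refl x ⟩
    x                         ∎)

  exp-cancel-< : ∀ {x y} → exp x < exp y → x < y
  exp-cancel-< expx<expy = ≰⇒> λ y≤x → <⇒≱ expx<expy (exp-mono y≤x)

  exp-cancel-≤ : ∀ {x y} → exp x ≤ exp y → x ≤ y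
  exp-cancel-≤ {x} {y} expx≤expy with x ≤? y
  ... | yes x≤y = x≤y
  ... | no  x≰y = ⊥-elim (<⇒≱ (exp-mono-< (≰⇒> x≰y)) expx≤expy)

  exp-injective : ∀ {x y} → exp x ≈ exp y → x ≈ y
  exp-injective eq =
    antisym (exp-cancel-≤ (≤-reflexive eq)) (exp-cancel-≤ (≤-reflexive (≈-sym eq)))

  exp-^ : ∀ x n → exp x ^ n ≈ exp (fromℕ n * x)
  exp-^ x zero = begin-equality
    1#             ≈⟨ exp-0 ⟨
    exp 0#         ≈⟨ exp-cong (zeroˡ x) ⟨
    exp (0# * x)   ∎
  exp-^ x (suc n) = begin-equality
    exp x * exp x ^ n            ≈⟨ *-congˡ (exp-^ x n) ⟩
    exp x * exp (fromℕ n * x)    ≈⟨ exp-+ _ _ ⟨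
    exp (x + fromℕ n * x)
      ≈⟨ exp-cong (solve 2 (λ x n → x :+ n :* x := (con (+ 1) :+ n) :* x) ≈-refl x (fromℕ n)) ⟩
    exp (fromℕ (suc n) * x)      ∎

  ^-nonNegative : ∀ {x} n → 0# ≤ x → 0# ≤ x ^ n
  ^-nonNegative zero    0≤x = 0≤1
  ^-nonNegative (suc n) 0≤x = *-nonNegative 0≤x (^-nonNegative n 0≤x)

  ^-monoˡ-≤ : ∀ {x y} n → 0# ≤ x → x ≤ y → x ^ n ≤ y ^ n
  ^-monoˡ-≤ zero    0≤x x≤y = ≤-refl
  ^-monoˡ-≤ (suc n) 0≤x x≤y =
    *-mono-≤ 0≤x (^-nonNegative n (≤-trans 0≤x x≤y)) x≤y (^-monoˡ-≤ n 0≤x x≤y)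

  -- The inequality for `(1 - h/a)` cleared of denominators. The induction multiplies by `a - h` and
  -- discards a nonnegative term in `h * h`.
  bernoulli : ∀ {a h} n → 0# ≤ h → h ≤ a →
              a ^ suc n - fromℕ (suc n) * (h * a ^ n) ≤ (a - h) ^ suc n
  bernoulli {a} {h} zero 0≤h h≤a = ≤-reflexive
    (solve 2 (λ a h → a :* con (+ 1) :- (con (+ 1) :+ con (+ 0)) :* (h :* con (+ 1))
                      := (a :- h) :* con (+ 1)) ≈-refl a h)
  bernoulli {a} {h} (suc n) 0≤h h≤a = begin
    a ^ suc (suc n) - fromℕ (suc (suc n)) * (h * a ^ suc n)
      ≤⟨ ≤-by (fromℕ (suc n) * (h * h * a ^ n))
           (*-nonNegative (0≤fromℕ (suc n)) (*-nonNegative (0≤x*x h) (^-nonNegative n (≤-trans 0≤h h≤a))))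
           (solve 4 (λ a h p n →
             a :* (a :* p) :- (con (+ 1) :+ n) :* (h :* (a :* p)) :+ n :* (h :* h :* p)
               := (a :- h) :* (a :* p :- n :* (h :* p))) ≈-refl a h (a ^ n) (fromℕ (suc n))) ⟩
    (a - h) * (a ^ suc n - fromℕ (suc n) * (h * a ^ n))
      ≤⟨ *-monoˡ-≤ (0≤-diff h≤a) (bernoulli n 0≤h h≤a) ⟩
    (a - h) ^ suc (suc n) ∎

  -- Multiplying 1 - z/(N+B) by 1 + z/N ≤ exp (z/N) gives at least 1.
  exp-≤-^ : ∀ {z B} N → 0# ≤ z → z ≤ B →
            exp (- z) ≤ (1# - z / (fromℕ (suc N) + B)) ^ suc N
  exp-≤-^ {z} {B} N 0≤z z≤B = begin
    exp (- z)                          ≈⟨ exp-cong exponent ⟩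
    exp (fromℕ (suc N) * - (z / n))    ≈⟨ exp-^ (- (z / n)) (suc N) ⟨
    exp (- (z / n)) ^ suc N            ≤⟨ ^-monoˡ-≤ (suc N) (0≤exp _) base ⟩
    (1# - z / D) ^ suc N               ∎
    where
    n = fromℕ (suc N)
    D = n + B
    0<n = 0<fromℕ N
    0<D : 0# < D
    0<D = +-positive 0<n (≤-trans 0≤z z≤B)
    exponent : - z ≈ n * - (z / n)
    exponent = begin-equality
      - z               ≈⟨ -‿cong (/-cancelʳ z 0<n) ⟨
      - (z / n * n)     ≈⟨ solve 2 (λ q n → :- (q :* n) := n :* :- q) ≈-refl (z / n) n ⟩
      n * - (z / n)     ∎
    z≤D : z ≤ D
    z≤D = ≤-trans z≤B (≤-by n (<⇒≤ 0<n) (+-comm _ _))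
    0≤1-z/D : 0# ≤ 1# - z / D
    0≤1-z/D = 0≤-diff (*-cancelˡ-≤ 0<D (begin
      D * (z / D)  ≈⟨ *-comm _ _ ⟩
      z / D * D    ≈⟨ /-cancelʳ z 0<D ⟩
      z            ≤⟨ z≤D ⟩
      D            ≈⟨ *-identityʳ D ⟨
      D * 1#       ∎))
    -- The right side is `(D - z) * (n + z)`, which exceeds `D * n` by `z * (B - z)`. The shift of
    -- the denominator by `B` is there to make this excess nonnegative for every `z` up to `B`.
    scaled : D * n ≤ D * n * ((1# - z / D) * (1# + z / n))
    scaled = ≤-by (z * (B - z)) (*-nonNegative 0≤z (0≤-diff z≤B)) (begin-equality
      D * n + z * (B - z)
        ≈⟨ solve 3 (λ n B z → (n :+ B) :* n :+ z :* (B :- z)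
                     := (n :+ B :- z) :* (n :+ z)) ≈-refl n B z ⟩
      (D - z) * (n + z)
        ≈⟨ *-cong (+-congˡ (-‿cong (/-cancelʳ z 0<D))) (+-congˡ (/-cancelʳ z 0<n)) ⟨
      (D - z / D * D) * (n + z / n * n)
        ≈⟨ solve 4 (λ D n q r → (D :- q :* D) :* (n :+ r :* n)
                     := D :* n :* ((con (+ 1) :- q) :* (con (+ 1) :+ r))) ≈-refl D n (z / D) (z / n) ⟩
      D * n * ((1# - z / D) * (1# + z / n)) ∎)
    base : exp (- (z / n)) ≤ 1# - z / D
    base = begin
      exp (- (z / n))
        ≈⟨ *-identityʳ _ ⟨
      exp (- (z / n)) * 1#
        ≤⟨ *-monoˡ-≤ (0≤exp _) (*-cancelˡ-≤ (*-positive 0<D 0<n) (≤-trans (≤-reflexive (*-identityʳ _)) scaled)) ⟩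
      exp (- (z / n)) * ((1# - z / D) * (1# + z / n))
        ≤⟨ *-monoˡ-≤ (0≤exp _) (*-monoˡ-≤ 0≤1-z/D (1+x≤exp _)) ⟩
      exp (- (z / n)) * ((1# - z / D) * exp (z / n))
        ≈⟨ solve 3 (λ a b c → a :* (b :* c) := a :* c :* b) ≈-refl _ _ _ ⟩
      exp (- (z / n)) * exp (z / n) * (1# - z / D)
        ≈⟨ *-congʳ (exp-inverse _) ⟩
      1# * (1# - z / D)
        ≈⟨ *-identityˡ _ ⟩
      1# - z / D ∎

  ^-≤-exp : ∀ {y} N → 0# ≤ 1# + y → (1# + y) ^ N ≤ exp (fromℕ N * y)
  ^-≤-exp {y} N 0≤1+y = begin
    (1# + y) ^ N        ≤⟨ ^-monoˡ-≤ N 0≤1+y (1+x≤exp y) ⟩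
    exp y ^ N           ≈⟨ exp-^ y N ⟩
    exp (fromℕ N * y)   ∎

-- Finite sums, in particular over all subsets.

infix 4 _≟ˢ_
_≟ˢ_ : ∀ {n} → DecidableEquality (Subset n)
_≟ˢ_ = ≡-dec Bool._≟_

∈-allSubsets : ∀ {n} (S : Subset n) → S ∈ₗ allSubsets n
∈-allSubsets []            = here ≡.refl
∈-allSubsets (outside ∷ S) = ∈-++⁺ˡ (∈-map⁺ (outside ∷_) (∈-allSubsets S))
∈-allSubsets (inside  ∷ S) = ∈-++⁺ʳ _ (∈-map⁺ (inside ∷_) (∈-allSubsets S))

module Sums (ℝ : Reals) where
  open Reals ℝ
  open OrderedField ℝ

  𝟙 : Bool → Carrier
  𝟙 b = if b then 1# else 0#

  0≤𝟙 : ∀ b → 0# ≤ 𝟙 b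
  0≤𝟙 true  = 0≤1
  0≤𝟙 false = ≤-refl

  𝟙≤1 : ∀ b → 𝟙 b ≤ 1#
  𝟙≤1 true  = ≤-refl
  𝟙≤1 false = 0≤1

  𝟙-not : ∀ b → 𝟙 b + 𝟙 (not b) ≈ 1#
  𝟙-not true  = +-identityʳ 1#
  𝟙-not false = +-identityˡ 1#

  module _ {A : Set} where

    sum-cong : ∀ xs {f g : A → Carrier} → (∀ x → f x ≈ g x) → sumOver xs f ≈ sumOver xs g
    sum-cong []       f≈g = ≈-refl
    sum-cong (x ∷ xs) f≈g = +-cong (f≈g x) (sum-cong xs f≈g)

    sum-mono : ∀ xs {f g : A → Carrier} → (∀ x → f x ≤ g x) → sumOver xs f ≤ sumOver xs g
    sum-mono []       f≤g = ≤-refl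
    sum-mono (x ∷ xs) f≤g = +-mono-≤ (f≤g x) (sum-mono xs f≤g)

    sum-nonNegative : ∀ xs {f : A → Carrier} → (∀ x → 0# ≤ f x) → 0# ≤ sumOver xs f
    sum-nonNegative []       0≤f = ≤-refl
    sum-nonNegative (x ∷ xs) 0≤f = +-nonNegative (0≤f x) (sum-nonNegative xs 0≤f)

    sum-+ : ∀ xs (f g : A → Carrier) →
            sumOver xs (λ x → f x + g x) ≈ sumOver xs f + sumOver xs g
    sum-+ []       f g = ≈-sym (+-identityʳ 0#)
    sum-+ (x ∷ xs) f g = ≈-trans (+-congˡ (sum-+ xs f g))
      (solve 4 (λ a b c d → a :+ b :+ (c :+ d) := a :+ c :+ (b :+ d)) ≈-refl _ _ _ _)

    *-sumˡ : ∀ c xs (f : A → Carrier) → c * sumOver xs f ≈ sumOver xs (λ x → c * f x)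
    *-sumˡ c []       f = zeroʳ c
    *-sumˡ c (x ∷ xs) f = ≈-trans (distribˡ _ _ _) (+-congˡ (*-sumˡ c xs f))

    *-sumʳ : ∀ c xs (f : A → Carrier) → sumOver xs f * c ≈ sumOver xs (λ x → f x * c)
    *-sumʳ c []       f = zeroˡ c
    *-sumʳ c (x ∷ xs) f = ≈-trans (distribʳ _ _ _) (+-congˡ (*-sumʳ c xs f))

    sum-++ : ∀ xs ys (f : A → Carrier) → sumOver (xs ++ ys) f ≈ sumOver xs f + sumOver ys f
    sum-++ []       ys f = ≈-sym (+-identityˡ _)
    sum-++ (x ∷ xs) ys f = ≈-trans (+-congˡ (sum-++ xs ys f)) (≈-sym (+-assoc _ _ _))

    sum-map : ∀ {B : Set} (h : B → A) xs (f : A → Carrier) →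
              sumOver (List.map h xs) f ≈ sumOver xs (f ∘ h)
    sum-map h []       f = ≈-refl
    sum-map h (x ∷ xs) f = +-congˡ (sum-map h xs f)

    sum-filter : ∀ {P : Pred A 0ℓ} (P? : Decidable P) xs (f : A → Carrier) →
                 sumOver (filter P? xs) f ≈ sumOver xs (λ x → 𝟙 (does (P? x)) * f x)
    sum-filter P? []       f = ≈-refl
    sum-filter P? (x ∷ xs) f with does (P? x)
    ... | true  = +-cong (≈-sym (*-identityˡ _)) (sum-filter P? xs f)
    ... | false = ≈-trans (sum-filter P? xs f)
                    (≈-trans (≈-sym (+-identityˡ _)) (+-congʳ (≈-sym (zeroˡ _))))

    sum-0 : (xs : List A) → sumOver xs (λ _ → 0#) ≈ 0#
    sum-0 []       = ≈-refl
    sum-0 (x ∷ xs) = ≈-trans (+-identityˡ _) (sum-0 xs)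

    term≤sum : ∀ {xs x} {f : A → Carrier} → (∀ x → 0# ≤ f x) → x ∈ₗ xs → f x ≤ sumOver xs f
    term≤sum {_ ∷ xs} 0≤f (here ≡.refl) =
      ≤-by _ (sum-nonNegative xs 0≤f) ≈-refl
    term≤sum {y ∷ xs} {f = f} 0≤f (there x∈xs) =
      ≤-trans (term≤sum 0≤f x∈xs) (≤-by (f y) (0≤f y) (+-comm _ _))

  sum-swap : ∀ {A B : Set} xs ys (f : A → B → Carrier) →
             sumOver xs (λ x → sumOver ys (f x)) ≈ sumOver ys (λ y → sumOver xs (λ x → f x y))
  sum-swap []       ys f = ≈-sym (sum-0 ys)
  sum-swap (x ∷ xs) ys f = ≈-trans (+-congˡ (sum-swap xs ys f)) (≈-sym (sum-+ ys _ _))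

  sum-tabulate : ∀ {A : Set} {m} (g : Fin m → A) (f : A → Carrier) →
                 sumOver (List.tabulate g) f ≈ sumOver (allFin m) (f ∘ g)
  sum-tabulate {m = zero}  g f = ≈-refl
  sum-tabulate {m = suc m} g f = +-congˡ
    (≈-trans (sum-tabulate (g ∘ suc) f) (≈-sym (sum-tabulate suc (f ∘ g))))

  sum-allFin-suc : ∀ {m} (f : Fin (suc m) → Carrier) →
                   sumOver (allFin (suc m)) f ≈ f zero + sumOver (allFin m) (f ∘ suc)
  sum-allFin-suc f = +-congˡ (sum-tabulate suc f)

  sum-allFin-const : ∀ m c → sumOver (allFin m) (λ _ → c) ≈ fromℕ m * c
  sum-allFin-const zero    c = ≈-sym (zeroˡ c)
  sum-allFin-const (suc m) c = ≈-trans (sum-allFin-suc {m} _)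
    (≈-trans (+-congˡ (sum-allFin-const m c))
      (solve 2 (λ c n → c :+ n :* c := (con (+ 1) :+ n) :* c) ≈-refl c (fromℕ m)))

  fromℕ-∣tabulate∣ : ∀ {m} (b : Fin m → Bool) →
                     fromℕ ∣ tabulate b ∣ ≈ sumOver (allFin m) (𝟙 ∘ b)
  fromℕ-∣tabulate∣ {zero}  b = ≈-refl
  fromℕ-∣tabulate∣ {suc m} b with b zero | sum-allFin-suc (𝟙 ∘ b)
  ... | true  | eq = ≈-trans (+-congˡ (fromℕ-∣tabulate∣ (b ∘ suc))) (≈-sym eq)
  ... | false | eq =
    ≈-trans (fromℕ-∣tabulate∣ (b ∘ suc)) (≈-sym (≈-trans eq (+-identityˡ _)))

  subsetSum : ∀ {n} → (Subset n → Carrier) → Carrier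
  subsetSum {n} f = sumOver (allSubsets n) f

  subsetSum-suc : ∀ {n} (f : Subset (suc n) → Carrier) →
                  subsetSum f ≈ subsetSum (f ∘ (outside ∷_)) + subsetSum (f ∘ (inside ∷_))
  subsetSum-suc {n} f = ≈-trans (sum-++ (List.map (outside ∷_) (allSubsets n)) _ f)
    (+-cong (sum-map _ (allSubsets n) f) (sum-map _ (allSubsets n) f))

  subsetSum-1 : ∀ n → subsetSum {n} (λ _ → 1#) ≈ fromℕ 2 ^ n
  subsetSum-1 zero    = +-identityʳ 1#
  subsetSum-1 (suc n) = ≈-trans (subsetSum-suc {n} _)
    (≈-trans (+-cong (subsetSum-1 n) (subsetSum-1 n))
      (solve 1 (λ x → x :+ x := con (+ 2) :* x) ≈-refl _))

  -- Splits off an arbitrary coordinate, because a contraction may delete any vertex.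
  subsetSum-insertAt : ∀ {n} (v : Fin (suc n)) (f : Subset (suc n) → Carrier) →
                       subsetSum f ≈
                       subsetSum (λ S → f (insertAt S v outside) + f (insertAt S v inside))
  subsetSum-insertAt {n} zero f = ≈-trans (subsetSum-suc f) (≈-sym (sum-+ (allSubsets n) _ _))
  subsetSum-insertAt {suc n} (suc v) f = ≈-trans (subsetSum-suc f)
    (≈-trans (+-cong (subsetSum-insertAt v _) (subsetSum-insertAt v _)) (≈-sym (subsetSum-suc {n} _)))

  -- Symmetric difference with `A` permutes the subsets: each coordinate of `A` either keeps or
  -- swaps the two halves of the sum.
  subsetSum-xor : ∀ {n} (A : Subset n) (f : Subset n → Carrier) →
                  subsetSum (f ∘ zipWith _xor_ A) ≈ subsetSum f
  subsetSum-xor []      f = ≈-refl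
  subsetSum-xor (outside ∷ A) f = ≈-trans (subsetSum-suc (f ∘ zipWith _xor_ (outside ∷ A)))
    (≈-trans (+-cong (subsetSum-xor A _) (subsetSum-xor A _)) (≈-sym (subsetSum-suc f)))
  subsetSum-xor (inside ∷ A) f = ≈-trans (subsetSum-suc (f ∘ zipWith _xor_ (inside ∷ A)))
    (≈-trans (+-cong (subsetSum-xor A _) (subsetSum-xor A _))
      (≈-trans (+-comm _ _) (≈-sym (subsetSum-suc f))))

  -- The indicator is the one in `distinct`, so one failed cut can be separated from the others in
  -- `cutFails≤`.
  subsetSum-remove : ∀ {n} (S₀ : Subset n) (f : Subset n → Carrier) →
                     subsetSum f ≈ f S₀ + subsetSum (λ S → 𝟙 (not (does (S ≟ˢ S₀))) * f S)
  subsetSum-remove [] f = ≈-sym (+-congˡ (≈-trans (+-identityʳ _) (zeroˡ _)))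
  subsetSum-remove {suc n} (outside ∷ S₀) f = ≈-trans (subsetSum-suc f) (≈-trans
    (+-cong (subsetSum-remove S₀ _) (sum-cong (allSubsets n) λ _ → ≈-sym (*-identityˡ _)))
    (≈-trans (+-assoc _ _ _) (+-congˡ (≈-sym (subsetSum-suc {n} _)))))
  subsetSum-remove {suc n} (inside ∷ S₀) f = ≈-trans (subsetSum-suc f) (≈-trans
    (+-cong (sum-cong (allSubsets n) λ _ → ≈-sym (*-identityˡ _)) (subsetSum-remove S₀ _))
    (≈-trans (solve 3 (λ a b c → a :+ (b :+ c) := b :+ (a :+ c)) ≈-refl _ _ _)
      (+-congˡ (≈-sym (subsetSum-suc {n} _)))))

-- Cuts under contraction of an edge.

-- A cut is given by any subset with a vertex on either side, with no normalisation at vertex zero: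
-- contraction renumbers the vertices and would not preserve one.
CutsAtLeast : ∀ {n} → ℕ → Graph n → Set
CutsAtLeast c G = ∀ S {a b} → lookup S a ≡ inside → lookup S b ≡ outside → c ℕ.≤ cutValue G S

crosses : ∀ {n} (G : Graph n) → Subset n → Fin (size G) → Bool
crosses G S e = lookup S (proj₁ (ends G e)) xor lookup S (proj₂ (ends G e))

isLoop : ∀ {n} (G : Graph n) → Fin (size G) → Bool
isLoop G e = does (proj₁ (ends G e) Fin.≟ proj₂ (ends G e))

-- Both cuts fail with probability `p` to this power.
jointValue : ∀ {n} → Graph n → Subset n → Subset n → ℕ
jointValue G S T = ∣ cutEdges G S ∪ cutEdges G T ∣

zipWith-tabulate : ∀ {A B C : Set} (_∙_ : A → B → C) {m} (f : Fin m → A) (g : Fin m → B) →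
                   zipWith _∙_ (tabulate f) (tabulate g) ≡ tabulate (λ i → f i ∙ g i)
zipWith-tabulate _∙_ {zero}  f g = ≡.refl
zipWith-tabulate _∙_ {suc m} f g = ≡.cong (_ ∷_) (zipWith-tabulate _∙_ (f ∘ suc) (g ∘ suc))

jointValue≡ : ∀ {n} (G : Graph n) S T →
              jointValue G S T ≡ ∣ tabulate (λ e → crosses G S e ∨ crosses G T e) ∣
jointValue≡ G S T = ≡.cong ∣_∣ (zipWith-tabulate _∨_ (crosses G S) (crosses G T))

module Contraction {k : ℕ} {u v : Fin (suc k)} (v≢u : v ≢ u) where

  merge : Fin (suc k) → Fin k
  merge a with v Fin.≟ a
  ... | yes _   = punchOut v≢u
  ... | no  v≢a = punchOut v≢a

  -- Edges keep their labels and the contracted edge stays as a loop. So `size` does not change, and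
  -- cut edges before and after are subsets of the same set.
  contract : Graph (suc k) → Graph k
  contract G = record
    { size = size G
    ; ends = λ e → merge (proj₁ (ends G e)) , merge (proj₂ (ends G e))
    }

  -- The preimage under `merge`. The subsets obtained in this way are exactly those that do not
  -- separate `u` from `v`.
  blowUp : Subset k → Subset (suc k)
  blowUp S = insertAt S v (lookup S (punchOut v≢u))

  lookup-blowUp : ∀ S a → lookup (blowUp S) a ≡ lookup S (merge a)
  lookup-blowUp S a with v Fin.≟ a
  ... | yes ≡.refl = insertAt-lookup S v _
  ... | no  v≢a    = ≡.trans (≡.cong (lookup (blowUp S)) (≡.sym (punchIn-punchOut v≢a)))
                       (insertAt-punchIn S v _ (punchOut v≢a))

  cutEdges-blowUp : ∀ G S → cutEdges G (blowUp S) ≡ cutEdges (contract G) S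
  cutEdges-blowUp G S = tabulate-cong λ e → ≡.cong₂ _xor_ (lookup-blowUp S _) (lookup-blowUp S _)

  contract-cutsAtLeast : ∀ {c} G → CutsAtLeast c G → CutsAtLeast c (contract G)
  contract-cutsAtLeast {c} G c≤ S {a} {b} Sa Sb =
    ≡.subst (c ℕ.≤_) (≡.cong ∣_∣ (cutEdges-blowUp G S))
      (c≤ (blowUp S) (≡.trans (insertAt-punchIn S v _ a) Sa) (≡.trans (insertAt-punchIn S v _ b) Sb))

-- Sums over unseparated pairs, and degree counting.

module CutCounting (ℝ : Reals) where
  open Reals ℝ
  open OrderedField ℝ
  open Sums ℝ

  fromℕ-cutValue : ∀ {n} (G : Graph n) S →
                   fromℕ (cutValue G S) ≈ sumOver (allFin (size G)) (𝟙 ∘ crosses G S)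
  fromℕ-cutValue G S = fromℕ-∣tabulate∣ (crosses G S)

  joint : ∀ {n} → Graph n → Subset n → Subset n → Carrier
  joint G S T = fromℕ (jointValue G S T)

  joint≈ : ∀ {n} (G : Graph n) S T → joint G S T ≈
           sumOver (allFin (size G)) (λ e → 𝟙 (crosses G S e ∨ crosses G T e))
  joint≈ G S T = ≈-trans (≈-reflexive (≡.cong fromℕ (jointValue≡ G S T)))
    (fromℕ-∣tabulate∣ λ e → crosses G S e ∨ crosses G T e)

  module _ {k : ℕ} {u v : Fin (suc k)} (v≢u : v ≢ u) where
    open Contraction v≢u

    -- A subset of the vertices other than `v` has two extensions to `v`; the indicator selects the
    -- one that puts `v` on the side of `u`.
    subsetSum-blowUp : (f : Subset (suc k) → Carrier) →
      subsetSum (λ S → 𝟙 (not (lookup S u xor lookup S v)) * f S) ≈ subsetSum (f ∘ blowUp)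
    subsetSum-blowUp f = ≈-trans (subsetSum-insertAt v _) (sum-cong (allSubsets k) λ S →
      ≈-trans
        (≈-reflexive (≡.cong₂ _+_ (term S outside) (term S inside)))
        (select (lookup S (punchOut v≢u)) (λ b → f (insertAt S v b))))
      where
      at-u : ∀ S b → lookup (insertAt S v b) u ≡ lookup S (punchOut v≢u)
      at-u S b = ≡.trans (≡.cong (lookup (insertAt S v b)) (≡.sym (punchIn-punchOut v≢u)))
                   (insertAt-punchIn S v b (punchOut v≢u))
      term : ∀ S b → 𝟙 (not (lookup (insertAt S v b) u xor lookup (insertAt S v b) v)) * f (insertAt S v b)
                   ≡ 𝟙 (not (lookup S (punchOut v≢u) xor b)) * f (insertAt S v b)
      term S b = ≡.cong₂ (λ x y → 𝟙 (not (x xor y)) * f (insertAt S v b))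
                   (at-u S b) (insertAt-lookup S v b)
      select : ∀ b (g : Bool → Carrier) →
               𝟙 (not (b xor outside)) * g outside + 𝟙 (not (b xor inside)) * g inside ≈ g b
      select inside  g = ≈-trans (+-cong (zeroˡ _) (*-identityˡ _)) (+-identityˡ _)
      select outside g = ≈-trans (+-cong (*-identityˡ _) (zeroˡ _)) (+-identityʳ _)

    -- The indicator factors into one for `S` and one for `T`, so `subsetSum-blowUp` applies twice.
    pairSum-blowUp : (f : Subset (suc k) → Subset (suc k) → Carrier) →
      subsetSum (λ S → subsetSum λ T →
        𝟙 (not ((lookup S u xor lookup S v) ∨ (lookup T u xor lookup T v))) * f S T) ≈
      subsetSum (λ S → subsetSum λ T → f (blowUp S) (blowUp T))
    pairSum-blowUp f = begin-equality
      subsetSum (λ S → subsetSum λ T →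
        𝟙 (not ((lookup S u xor lookup S v) ∨ (lookup T u xor lookup T v))) * f S T)
        ≈⟨ sum-cong subsets (λ S → ≈-trans
             (sum-cong subsets λ T → ≈-trans
               (*-congʳ (𝟙-not-∨ (lookup S u xor lookup S v) (lookup T u xor lookup T v)))
               (*-assoc _ _ _))
             (≈-sym (*-sumˡ _ subsets _))) ⟩
      subsetSum (λ S → 𝟙 (not (lookup S u xor lookup S v)) *
        subsetSum λ T → 𝟙 (not (lookup T u xor lookup T v)) * f S T)
        ≈⟨ sum-cong subsets (λ S → *-congˡ (subsetSum-blowUp (f S))) ⟩
      subsetSum (λ S → 𝟙 (not (lookup S u xor lookup S v)) * subsetSum λ T → f S (blowUp T))
        ≈⟨ subsetSum-blowUp _ ⟩
      subsetSum (λ S → subsetSum λ T → f (blowUp S) (blowUp T)) ∎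
      where
      subsets = allSubsets (suc k)
      𝟙-not-∨ : ∀ a b → 𝟙 (not (a ∨ b)) ≈ 𝟙 (not a) * 𝟙 (not b)
      𝟙-not-∨ true  b = ≈-sym (zeroˡ _)
      𝟙-not-∨ false b = ≈-sym (*-identityˡ _)

  sum-≟ : ∀ {k} (a : Fin k) → sumOver (allFin k) (λ v → 𝟙 (does (v Fin.≟ a))) ≈ 1#
  sum-≟ {suc k} zero = ≈-trans (sum-allFin-suc {k} _)
    (≈-trans (+-congˡ (sum-0 (allFin k))) (+-identityʳ 1#))
  sum-≟ {suc k} (suc a) = ≈-trans (sum-allFin-suc {k} _) (≈-trans (+-identityˡ _) (sum-≟ a))

  nonLoops : ∀ {k} → Graph k → Carrier
  nonLoops G = sumOver (allFin (size G)) (𝟙 ∘ not ∘ isLoop G)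

  -- Double counting of incidences: the star of each vertex is a cut, a non-loop lies in the stars
  -- of its two ends only, a loop in none. With at least two vertices, `punchIn v zero` is a vertex
  -- other than `v`.
  handshake : ∀ {k c} (G : Graph (suc (suc k))) → CutsAtLeast c G →
              fromℕ (suc (suc k)) * fromℕ c ≤ fromℕ 2 * nonLoops G
  handshake {k} {c} G c≤ = begin
    fromℕ K * fromℕ c
      ≈⟨ sum-allFin-const K (fromℕ c) ⟨
    sumOver (allFin K) (λ _ → fromℕ c)
      ≤⟨ sum-mono (allFin K) degree ⟩
    sumOver (allFin K) (λ v → sumOver (allFin (size G)) λ e → 𝟙 (crosses G (star v) e))
      ≈⟨ sum-swap (allFin K) (allFin (size G)) _ ⟩
    sumOver (allFin (size G)) (λ e → sumOver (allFin K) λ v → 𝟙 (crosses G (star v) e))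
      ≤⟨ sum-mono (allFin (size G)) (λ e → incidences (proj₁ (ends G e)) (proj₂ (ends G e))) ⟩
    sumOver (allFin (size G)) (λ e → fromℕ 2 * 𝟙 (not (isLoop G e)))
      ≈⟨ *-sumˡ (fromℕ 2) (allFin (size G)) _ ⟨
    fromℕ 2 * nonLoops G ∎
    where
    K = suc (suc k)
    star : Fin K → Subset K
    star v = tabulate λ a → does (v Fin.≟ a)
    lookup-star : ∀ v a → lookup (star v) a ≡ does (v Fin.≟ a)
    lookup-star v = lookup∘tabulate _
    degree : ∀ v → fromℕ c ≤ sumOver (allFin (size G)) λ e → 𝟙 (crosses G (star v) e)
    degree v = ≤-trans
      (fromℕ-mono (c≤ (star v) {v} {punchIn v zero}
        (≡.trans (lookup-star v v) (dec-true (v Fin.≟ v) ≡.refl))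
        (≡.trans (lookup-star v (punchIn v zero)) (dec-false (v Fin.≟ _) (punchInᵢ≢i v zero ∘ ≡.sym)))))
      (≤-reflexive (fromℕ-cutValue G (star v)))
    𝟙-xor : ∀ a b → 𝟙 (a xor b) ≤ 𝟙 a + 𝟙 b
    𝟙-xor true  b = ≤-trans (𝟙≤1 (not b)) (≤-by (𝟙 b) (0≤𝟙 b) ≈-refl)
    𝟙-xor false b = ≤-reflexive (≈-sym (+-identityˡ _))
    incidences : ∀ a b → sumOver (allFin K) (λ v → 𝟙 (lookup (star v) a xor lookup (star v) b)) ≤
                         fromℕ 2 * 𝟙 (not (does (a Fin.≟ b)))
    incidences a b with a Fin.≟ b
    ... | yes ≡.refl = begin
      sumOver (allFin K) (λ v → 𝟙 (lookup (star v) a xor lookup (star v) a))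
        ≈⟨ sum-cong (allFin K) (λ v → ≈-reflexive (≡.cong 𝟙 (xor-same (lookup (star v) a)))) ⟩
      sumOver (allFin K) (λ _ → 0#)
        ≈⟨ sum-0 (allFin K) ⟩
      0#
        ≈⟨ zeroʳ _ ⟨
      fromℕ 2 * 0# ∎
    ... | no _ = begin
      sumOver (allFin K) (λ v → 𝟙 (lookup (star v) a xor lookup (star v) b))
        ≤⟨ sum-mono (allFin K) (λ v → ≤-trans (𝟙-xor (lookup (star v) a) _) (≤-reflexive
             (≈-reflexive (≡.cong₂ (λ x y → 𝟙 x + 𝟙 y) (lookup-star v a) (lookup-star v b))))) ⟩
      sumOver (allFin K) (λ v → 𝟙 (does (v Fin.≟ a)) + 𝟙 (does (v Fin.≟ b)))
        ≈⟨ sum-+ (allFin K) _ _ ⟩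
      sumOver (allFin K) (λ v → 𝟙 (does (v Fin.≟ a))) + sumOver (allFin K) (λ v → 𝟙 (does (v Fin.≟ b)))
        ≈⟨ +-cong (sum-≟ a) (sum-≟ b) ⟩
      1# + 1#
        ≈⟨ solve 0 (con (+ 1) :+ con (+ 1) := con (+ 2) :* con (+ 1)) ≈-refl ⟩
      fromℕ 2 * 1# ∎

-- The random contraction process and its survival bound.

module ContractionProcess (ℝ : Reals) where
  open Reals ℝ
  open OrderedField ℝ
  open Sums ℝ
  open CutCounting ℝ

  1^≈1 : ∀ N → 1# ^ N ≈ 1#
  1^≈1 zero    = ≈-refl
  1^≈1 (suc N) = ≈-trans (*-identityˡ _) (1^≈1 N)

  pairSum-1 : ∀ n → subsetSum {n} (λ S → subsetSum {n} λ T → 1#) ≈ fromℕ 4 ^ n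
  pairSum-1 n = begin-equality
    subsetSum {n} (λ S → subsetSum {n} λ T → 1#)
      ≈⟨ sum-cong (allSubsets n) (λ _ → ≈-trans (subsetSum-1 n) (≈-sym (*-identityʳ _))) ⟩
    subsetSum {n} (λ S → fromℕ 2 ^ n * 1#)
      ≈⟨ *-sumˡ (fromℕ 2 ^ n) (allSubsets n) _ ⟨
    fromℕ 2 ^ n * subsetSum {n} (λ S → 1#)
      ≈⟨ *-congˡ (subsetSum-1 n) ⟩
    fromℕ 2 ^ n * fromℕ 2 ^ n
      ≈⟨ square n ⟩
    fromℕ 4 ^ n ∎
    where
    square : ∀ n → fromℕ 2 ^ n * fromℕ 2 ^ n ≈ fromℕ 4 ^ n
    square zero    = *-identityˡ 1#
    square (suc n) = ≈-trans
      (solve 1 (λ x → con (+ 2) :* x :* (con (+ 2) :* x) := con (+ 4) :* (x :* x)) ≈-refl (fromℕ 2 ^ n))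
      (*-congˡ (square n))

  module _ (c : ℕ) {κ : Carrier} (0≤κ : 0# ≤ κ) (0≤1-κc : 0# ≤ 1# - κ * fromℕ c) where

    -- The 2 cancels the one in `handshake`: on `n ≥ 2` vertices a round contracts a non-loop with
    -- probability at least `κ * n * c`.
    rate : Carrier
    rate = fromℕ 2 * κ

    0≤rate : 0# ≤ rate
    0≤rate = *-nonNegative (0≤fromℕ 2) 0≤κ

    -- The expected number of pairs surviving `N` rounds. Trivial subsets are included, so that the
    -- pairs not crossed by an edge correspond to all pairs of the contracted graph.
    Z : ∀ {n} → ℕ → Graph n → Carrier
    Z N G = subsetSum λ S → subsetSum λ T → (1# - rate * joint G S T) ^ N

    -- The contraction probabilities of all edges add up to at most 1; the remainder is the
    -- probability of an idle round. Since `contract` keeps `size`, it keeps this too.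
    Slow : ∀ {n} → Graph n → Set
    Slow G = 0# ≤ 1# - rate * fromℕ (size G)

    -- The initial value 3 makes `(1# + ρ 0) ^ n` the number of pairs of subsets; each round
    -- multiplies by `1 - κc`.
    ρ : ℕ → Carrier
    ρ N = fromℕ 3 * (1# - κ * fromℕ c) ^ N

    0≤ρ : ∀ N → 0# ≤ ρ N
    0≤ρ N = *-nonNegative (0≤fromℕ 3) (^-nonNegative N 0≤1-κc)

    0≤1+ρ : ∀ N → 0# ≤ 1# + ρ N
    0≤1+ρ N = +-nonNegative 0≤1 (0≤ρ N)

    -- The leading 4 pays for a single vertex, whose four pairs of subsets survive every round.
    bound : ℕ → ℕ → Carrier
    bound N n = fromℕ 4 * (1# + ρ N) ^ n

    module _ {n : ℕ} (G : Graph n) (slow : Slow G) where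

      0≤1-rate*joint : ∀ S T → 0# ≤ 1# - rate * joint G S T
      0≤1-rate*joint S T = ≤-trans slow (+-monoʳ-≤ 1# (neg-antimono-≤
        (*-monoˡ-≤ 0≤rate (fromℕ-mono (∣p∣≤n (cutEdges G S ∪ cutEdges G T))))))

      1-rate*joint≤1 : ∀ S T → 1# - rate * joint G S T ≤ 1#
      1-rate*joint≤1 S T = ≤-by (rate * joint G S T) (*-nonNegative 0≤rate (0≤fromℕ (jointValue G S T)))
        (solve 1 (λ x → con (+ 1) :- x :+ x := con (+ 1)) ≈-refl _)

      Z≤4^ : ∀ N → Z N G ≤ fromℕ 4 ^ n
      Z≤4^ N = ≤-trans
        (sum-mono (allSubsets n) λ S → sum-mono (allSubsets n) λ T →
          ≤-trans (^-monoˡ-≤ N (0≤1-rate*joint S T) (1-rate*joint≤1 S T)) (≤-reflexive (1^≈1 N)))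
        (≤-reflexive (pairSum-1 n))

    uncut : ∀ {n} (G : Graph n) (S T : Subset n) → Fin (size G) → Carrier
    uncut G S T e = 𝟙 (not (crosses G S e ∨ crosses G T e))

    uncutSum : ∀ {n} → ℕ → (G : Graph n) → Fin (size G) → Carrier
    uncutSum N G e = subsetSum λ S → subsetSum λ T → uncut G S T e * (1# - rate * joint G S T) ^ N

    -- One round: with probability rate, each edge is the one that gets contracted.
    Z-suc : ∀ {n} N (G : Graph n) → Z (suc N) G ≈
            (1# - rate * fromℕ (size G)) * Z N G + rate * sumOver (allFin (size G)) (uncutSum N G)
    Z-suc {n} N G = begin-equality
      Z (suc N) G
        ≈⟨ sum-cong subsets (λ S → ≈-trans (sum-cong subsets (split S)) (≈-trans (sum-+ subsets _ _)
             (+-cong (≈-sym (*-sumˡ _ subsets _))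
                     (≈-trans (≈-sym (*-sumˡ _ subsets _)) (*-congˡ (sum-swap subsets edges _)))))) ⟩
      subsetSum (λ S → idle * subsetSum (power S) +
        rate * sumOver edges (λ e → subsetSum λ T → uncut G S T e * power S T))
        ≈⟨ sum-+ subsets _ _ ⟩
      subsetSum (λ S → idle * subsetSum (power S)) +
        subsetSum (λ S → rate * sumOver edges (λ e → subsetSum λ T → uncut G S T e * power S T))
        ≈⟨ +-cong (*-sumˡ idle subsets _) (*-sumˡ rate subsets _) ⟨
      idle * Z N G +
        rate * subsetSum (λ S → sumOver edges (λ e → subsetSum λ T → uncut G S T e * power S T))
        ≈⟨ +-congˡ (*-congˡ (sum-swap subsets edges _)) ⟩
      idle * Z N G + rate * sumOver edges (uncutSum N G) ∎
      where
      subsets = allSubsets n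
      edges   = allFin (size G)
      idle    = 1# - rate * fromℕ (size G)
      power : Subset n → Subset n → Carrier
      power S T = (1# - rate * joint G S T) ^ N
      joint+uncut : ∀ S T → joint G S T + sumOver edges (uncut G S T) ≈ fromℕ (size G)
      joint+uncut S T = begin-equality
        joint G S T + sumOver edges (uncut G S T)
          ≈⟨ +-congʳ (joint≈ G S T) ⟩
        sumOver edges (λ e → 𝟙 (crosses G S e ∨ crosses G T e)) + sumOver edges (uncut G S T)
          ≈⟨ sum-+ edges _ _ ⟨
        sumOver edges (λ e → 𝟙 (crosses G S e ∨ crosses G T e) + uncut G S T e)
          ≈⟨ sum-cong edges (λ e → 𝟙-not (crosses G S e ∨ crosses G T e)) ⟩
        sumOver edges (λ _ → 1#)
          ≈⟨ sum-allFin-const (size G) 1# ⟩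
        fromℕ (size G) * 1#
          ≈⟨ *-identityʳ _ ⟩
        fromℕ (size G) ∎
      split : ∀ S T → (1# - rate * joint G S T) * power S T ≈
              idle * power S T + rate * sumOver edges (λ e → uncut G S T e * power S T)
      split S T = begin-equality
        (1# - rate * joint G S T) * power S T
          ≈⟨ solve 4 (λ r x y p → (con (+ 1) :- r :* x) :* p
                        := (con (+ 1) :- r :* (x :+ y)) :* p :+ r :* (y :* p)) ≈-refl
               rate (joint G S T) (sumOver edges (uncut G S T)) (power S T) ⟩
        (1# - rate * (joint G S T + sumOver edges (uncut G S T))) * power S T +
          rate * (sumOver edges (uncut G S T) * power S T)
          ≈⟨ +-cong (*-congʳ (+-congˡ (-‿cong (*-congˡ (joint+uncut S T)))))
                    (*-congˡ (*-sumʳ _ edges _)) ⟩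
        idle * power S T + rate * sumOver edges (λ e → uncut G S T e * power S T) ∎

    -- For a loop all pairs are counted, giving `B`; for a non-loop `pairSum-blowUp` leaves the
    -- pairs of the contracted graph, giving `B′`. One formula covers both cases, so that it can be
    -- summed over the edges.
    uncutSum-bound : ∀ {k} N {B B′} (G : Graph (suc k)) → Slow G → CutsAtLeast c G → Z N G ≤ B →
      ((H : Graph k) → Slow H → CutsAtLeast c H → Z N H ≤ B′) →
      ∀ e → uncutSum N G e ≤ B - 𝟙 (not (isLoop G e)) * (B - B′)
    uncutSum-bound {k} N {B} {B′} G slow c≤ Z≤B Z≤B′ e
      with proj₁ (ends G e) Fin.≟ proj₂ (ends G e)
    ... | yes _ = begin
      uncutSum N G e
        ≤⟨ sum-mono (allSubsets (suc k)) (λ S → sum-mono (allSubsets (suc k)) λ T →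
             ≤-trans (*-monoʳ-≤ (^-nonNegative N (0≤1-rate*joint G slow S T))
                        (𝟙≤1 (not (crosses G S e ∨ crosses G T e))))
                     (≤-reflexive (*-identityˡ _))) ⟩
      Z N G
        ≤⟨ Z≤B ⟩
      B
        ≈⟨ solve 2 (λ x y → x := x :- con (+ 0) :* (x :- y)) ≈-refl B B′ ⟩
      B - 0# * (B - B′) ∎
    ... | no u≢v = begin
      uncutSum N G e
        ≈⟨ pairSum-blowUp v≢u (λ S T → (1# - rate * joint G S T) ^ N) ⟩
      subsetSum (λ S → subsetSum λ T → (1# - rate * joint G (blowUp S) (blowUp T)) ^ N)
        ≈⟨ sum-cong (allSubsets k) (λ S → sum-cong (allSubsets k) λ T → ≈-reflexive
             (≡.cong₂ (λ C D → (1# - rate * fromℕ ∣ C ∪ D ∣) ^ N)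
               (cutEdges-blowUp G S) (cutEdges-blowUp G T))) ⟩
      Z N (contract G)
        ≤⟨ Z≤B′ (contract G) slow (contract-cutsAtLeast G c≤) ⟩
      B′
        ≈⟨ solve 2 (λ x y → y := x :- con (+ 1) :* (x :- y)) ≈-refl B B′ ⟩
      B - 1# * (B - B′) ∎
      where
      v≢u = u≢v ∘ ≡.sym
      open Contraction v≢u

    -- Contracting a non-loop lowers the bound from `B` to `B′`, and by `handshake` a round lowers
    -- it by at least `κ * n * c * (B - B′)` on average, where `B - B′` is `4ρ(1+ρ)^(n-1)`. Then
    -- `bernoulli` with `h = κ * c * ρ` moves the drop into the base, and `1 + ρ - h` is the next
    -- `1 + ρ`.
    Z-bound : ∀ N {k} (G : Graph (suc k)) → Slow G → CutsAtLeast c G → Z N G ≤ bound N (suc k)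
    Z-bound N {zero} G slow c≤ = ≤-trans (Z≤4^ G slow N) (*-monoˡ-≤ (0≤fromℕ 4)
      (≤-by (ρ N) (0≤ρ N) (solve 1 (λ r → con (+ 1) :+ r := (con (+ 1) :+ r) :* con (+ 1))
           ≈-refl (ρ N))))
    Z-bound zero {suc k} G slow c≤ = begin
      Z 0 G                                   ≤⟨ Z≤4^ G slow 0 ⟩
      fromℕ 4 ^ n
        ≈⟨ ^-congˡ n (solve 0 (con (+ 4) := con (+ 1) :+ con (+ 3) :* con (+ 1)) ≈-refl) ⟩
      (1# + ρ 0) ^ n
        ≤⟨ ≤-by _ (*-nonNegative (0≤fromℕ 3) (^-nonNegative n (0≤1+ρ 0)))
                                                   (solve 1 (λ x → x :+ con (+ 3) :* x := con (+ 4) :* x)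
                                                        ≈-refl ((1# + ρ 0) ^ n)) ⟩
      bound 0 n                               ∎
      where n = suc (suc k)
    Z-bound (suc N) {suc k} G slow c≤ = begin
      Z (suc N) G
        ≈⟨ Z-suc N G ⟩
      (1# - rate * m) * Z N G + rate * sumOver edges (uncutSum N G)
        ≤⟨ +-mono-≤ (*-monoˡ-≤ slow (Z-bound N G slow c≤))
             (*-monoˡ-≤ 0≤rate (sum-mono edges (uncutSum-bound N G slow c≤
               (Z-bound N G slow c≤) (λ H → Z-bound N H)))) ⟩
      (1# - rate * m) * B + rate * sumOver edges (λ e → B - 𝟙 (not (isLoop G e)) * (B - B′))
        ≈⟨ +-congˡ (*-congˡ total-bound) ⟩
      (1# - rate * m) * B + rate * (m * B + nonLoops G * - (B - B′))
        ≈⟨ solve 5 (λ κ m x B B′ →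
             (con (+ 1) :- con (+ 2) :* κ :* m) :* B :+ con (+ 2) :* κ :* (m :* B :+ x :* :- (B :- B′))
               := B :- κ :* (con (+ 2) :* x) :* (B :- B′)) ≈-refl κ m (nonLoops G) B B′ ⟩
      B - κ * (fromℕ 2 * nonLoops G) * (B - B′)
        ≤⟨ +-monoʳ-≤ B (neg-antimono-≤ (*-monoʳ-≤ 0≤B-B′ (*-monoˡ-≤ 0≤κ (handshake G c≤)))) ⟩
      B - κ * (fromℕ n * fromℕ c) * (B - B′)
        ≈⟨ solve 5 (λ κ n c r x →
             con (+ 4) :* ((con (+ 1) :+ r) :* x) :-
               κ :* (n :* c) :* (con (+ 4) :* ((con (+ 1) :+ r) :* x) :- con (+ 4) :* x)
               := con (+ 4) :* ((con (+ 1) :+ r) :* x :- n :* (κ :* c :* r :* x))) ≈-refl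
             κ (fromℕ n) (fromℕ c) (ρ N) ((1# + ρ N) ^ suc k) ⟩
      fromℕ 4 * ((1# + ρ N) ^ n - fromℕ n * (κ * fromℕ c * ρ N * (1# + ρ N) ^ suc k))
        ≤⟨ *-monoˡ-≤ (0≤fromℕ 4) (bernoulli (suc k) 0≤h h≤1+ρ) ⟩
      fromℕ 4 * (1# + ρ N - κ * fromℕ c * ρ N) ^ n
        ≈⟨ *-congˡ (^-congˡ n (solve 2 (λ y p →
             con (+ 1) :+ con (+ 3) :* p :- y :* (con (+ 3) :* p)
               := con (+ 1) :+ con (+ 3) :* ((con (+ 1) :- y) :* p)) ≈-refl
             (κ * fromℕ c) ((1# - κ * fromℕ c) ^ N))) ⟩
      bound (suc N) n ∎
      where
      n     = suc (suc k)
      m     = fromℕ (size G)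
      edges = allFin (size G)
      B     = bound N n
      B′    = bound N (suc k)
      total-bound : sumOver edges (λ e → B - 𝟙 (not (isLoop G e)) * (B - B′)) ≈
                    m * B + nonLoops G * - (B - B′)
      total-bound = begin-equality
        sumOver edges (λ e → B - 𝟙 (not (isLoop G e)) * (B - B′))
          ≈⟨ sum-cong edges (λ e → +-congˡ (solve 2 (λ x y → :- (x :* y) := x :* :- y) ≈-refl _ _)) ⟩
        sumOver edges (λ e → B + 𝟙 (not (isLoop G e)) * - (B - B′))
          ≈⟨ sum-+ edges _ _ ⟩
        sumOver edges (λ e → B) + sumOver edges (λ e → 𝟙 (not (isLoop G e)) * - (B - B′))
          ≈⟨ +-cong (sum-allFin-const (size G) B) (≈-sym (*-sumʳ _ edges _)) ⟩
        m * B + nonLoops G * - (B - B′) ∎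
      0≤B-B′ : 0# ≤ B - B′
      0≤B-B′ = begin
        0#
          ≤⟨ *-nonNegative (*-nonNegative (0≤fromℕ 4) (0≤ρ N)) (^-nonNegative (suc k) (0≤1+ρ N)) ⟩
        fromℕ 4 * ρ N * (1# + ρ N) ^ suc k
          ≈⟨ solve 2 (λ r x → con (+ 4) :* r :* x
                       := con (+ 4) :* ((con (+ 1) :+ r) :* x) :- con (+ 4) :* x) ≈-refl _ _ ⟩
        B - B′ ∎
      0≤h : 0# ≤ κ * fromℕ c * ρ N
      0≤h = *-nonNegative (*-nonNegative 0≤κ (0≤fromℕ c)) (0≤ρ N)
      h≤1+ρ : κ * fromℕ c * ρ N ≤ 1# + ρ N
      h≤1+ρ = ≤-by (1# + (1# - κ * fromℕ c) * ρ N)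
        (+-nonNegative 0≤1 (*-nonNegative 0≤1-κc (0≤ρ N)))
        (solve 2 (λ y r → y :* r :+ (con (+ 1) :+ (con (+ 1) :- y) :* r) := con (+ 1) :+ r) ≈-refl _ _)

-- From survival probabilities to an exponential sum over pairs of cuts.

module CutGeneratingFunction (ℝ : Reals) where
  open Reals ℝ
  open OrderedField ℝ
  open Sums ℝ
  open CutCounting ℝ
  open ContractionProcess ℝ

  K : Carrier
  K = fromℕ 4 * exp (fromℕ 3 * exp 1#)

  0<K : 0# < K
  0<K = *-positive (0<fromℕ 3) (0<exp _)

  -- No joint value exceeds `size G`, so `exp-≤-^` applies to all pairs with the same `B`, and each
  -- summand is at most a survival probability for `κ = t / D`. By `Z-bound` and `survival`, the
  -- total is at most 4 times the power of `1 + 3 exp (1 - ℓ)` with the number of vertices as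
  -- exponent, and that number is `exp ℓ`.
  pairSum-exp≤K : ∀ {k c} (G : Graph (suc k)) → CutsAtLeast c G → c ℕ.≤ size G →
    ∀ {ℓ t} → 0# ≤ ℓ → 0# ≤ t → exp ℓ ≈ fromℕ (suc k) → t * fromℕ c ≈ ℓ →
    subsetSum (λ S → subsetSum λ T → exp (- (fromℕ 2 * t * joint G S T))) ≤ K
  pairSum-exp≤K {k} {c} G c≤ c≤size {ℓ} {t} 0≤ℓ 0≤t expℓ≈n tc≈ℓ = begin
    subsetSum (λ S → subsetSum λ T → exp (- (fromℕ 2 * t * joint G S T)))
      ≤⟨ sum-mono (allSubsets (suc k)) (λ S → sum-mono (allSubsets (suc k)) (term S)) ⟩
    Z c 0≤κ 0≤1-κc (suc N) G
      ≤⟨ Z-bound c 0≤κ 0≤1-κc (suc N) G slow c≤ ⟩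
    fromℕ 4 * (1# + fromℕ 3 * (1# - κ * fromℕ c) ^ suc N) ^ suc k
      ≤⟨ *-monoˡ-≤ (0≤fromℕ 4) (^-monoˡ-≤ (suc k) (0≤1+ρ c 0≤κ 0≤1-κc (suc N))
           (+-monoʳ-≤ 1# (*-monoˡ-≤ (0≤fromℕ 3) survival))) ⟩
    fromℕ 4 * (1# + fromℕ 3 * exp (1# - ℓ)) ^ suc k
      ≤⟨ *-monoˡ-≤ (0≤fromℕ 4) (^-≤-exp (suc k)
           (+-nonNegative 0≤1 (*-nonNegative (0≤fromℕ 3) (0≤exp _)))) ⟩
    fromℕ 4 * exp (fromℕ (suc k) * (fromℕ 3 * exp (1# - ℓ)))
      ≈⟨ *-congˡ (exp-cong cancel-n) ⟩
    K ∎
    where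
    m = fromℕ (size G)
    B = fromℕ 2 * t * m
    0≤B : 0# ≤ B
    0≤B = *-nonNegative (*-nonNegative (0≤fromℕ 2) 0≤t) (0≤fromℕ (size G))
    -- Enough rounds that enlarging the denominator to `D` costs only a factor `exp 1#` in
    -- `survival`. Below, `n` counts rounds, not vertices.
    N = proj₁ (archimedean (ℓ * B))
    n = fromℕ (suc N)
    D = n + B
    0<D : 0# < D
    0<D = +-positive (0<fromℕ N) 0≤B
    κ = t / D
    0≤κ : 0# ≤ κ
    0≤κ = *-nonNegative 0≤t (<⇒≤ (⁻¹-positive 0<D))
    slow : 0# ≤ 1# - fromℕ 2 * κ * m
    slow = 0≤-diff (*-cancelˡ-≤ 0<D (begin
      D * (fromℕ 2 * κ * m)
        ≈⟨ solve 3 (λ D q m → D :* (con (+ 2) :* q :* m) := con (+ 2) :* (q :* D) :* m) ≈-refl D κ m ⟩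
      fromℕ 2 * (κ * D) * m
        ≈⟨ *-congʳ (*-congˡ (/-cancelʳ t 0<D)) ⟩
      B
        ≤⟨ ≤-by n (0≤fromℕ (suc N)) (+-comm _ _) ⟩
      D
        ≈⟨ *-identityʳ D ⟨
      D * 1# ∎))
    0≤1-κc : 0# ≤ 1# - κ * fromℕ c
    0≤1-κc = ≤-trans slow (+-monoʳ-≤ 1# (neg-antimono-≤ (begin
      κ * fromℕ c      ≤⟨ *-monoˡ-≤ 0≤κ (fromℕ-mono c≤size) ⟩
      κ * m            ≤⟨ ≤-by (κ * m) (*-nonNegative 0≤κ (0≤fromℕ (size G)))
                            (solve 2 (λ q m → q :* m :+ q :* m := con (+ 2) :* q :* m) ≈-refl κ m) ⟩
      fromℕ 2 * κ * m  ∎)))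
    term : ∀ S T → exp (- (fromℕ 2 * t * joint G S T)) ≤
                   (1# - fromℕ 2 * κ * joint G S T) ^ suc N
    term S T = ≤-trans
      (exp-≤-^ N (*-nonNegative (*-nonNegative (0≤fromℕ 2) 0≤t) (0≤fromℕ (jointValue G S T)))
        (*-monoˡ-≤ (*-nonNegative (0≤fromℕ 2) 0≤t)
          (fromℕ-mono (∣p∣≤n (cutEdges G S ∪ cutEdges G T)))))
      (≤-reflexive (^-congˡ (suc N) (+-congˡ (-‿cong
        (solve 3 (λ t x d → con (+ 2) :* t :* x :* d := con (+ 2) :* (t :* d) :* x) ≈-refl
          t (joint G S T) (D ⁻¹))))))
    survival : (1# - κ * fromℕ c) ^ suc N ≤ exp (1# - ℓ)
    survival = ≤-trans (^-≤-exp (suc N) 0≤1-κc) (exp-mono (*-cancelˡ-≤ 0<D (begin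
      D * (n * - (κ * fromℕ c))
        ≈⟨ solve 4 (λ D n q c → D :* (n :* :- (q :* c)) := :- (n :* (q :* D :* c)))
             ≈-refl D n κ (fromℕ c) ⟩
      - (n * (κ * D * fromℕ c))
        ≈⟨ -‿cong (*-congˡ (≈-trans (*-congʳ (/-cancelʳ t 0<D)) tc≈ℓ)) ⟩
      - (n * ℓ)
        ≤⟨ ≤-by _ (+-nonNegative (0≤-diff ℓB≤n) 0≤B)
             (solve 3 (λ n ℓ B → :- (n :* ℓ) :+ (n :- ℓ :* B :+ B)
                         := (n :+ B) :* (con (+ 1) :- ℓ)) ≈-refl n ℓ B) ⟩
      D * (1# - ℓ) ∎)))
      where
      ℓB≤n : ℓ * B ≤ n
      ℓB≤n = ≤-trans (proj₂ (archimedean (ℓ * B))) (≤-by 1# 0≤1 (+-comm _ _))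
    cancel-n : fromℕ (suc k) * (fromℕ 3 * exp (1# - ℓ)) ≈ fromℕ 3 * exp 1#
    cancel-n = begin-equality
      fromℕ (suc k) * (fromℕ 3 * exp (1# - ℓ))
        ≈⟨ *-congʳ expℓ≈n ⟨
      exp ℓ * (fromℕ 3 * exp (1# - ℓ))
        ≈⟨ solve 3 (λ a b c → a :* (b :* c) := b :* (a :* c)) ≈-refl _ _ _ ⟩
      fromℕ 3 * (exp ℓ * exp (1# - ℓ))
        ≈⟨ *-congˡ (exp-+ _ _) ⟨
      fromℕ 3 * exp (ℓ + (1# - ℓ))
        ≈⟨ *-congˡ (exp-cong (solve 1 (λ x → x :+ (con (+ 1) :- x) := con (+ 1)) ≈-refl ℓ)) ⟩
      fromℕ 3 * exp 1# ∎

-- Disconnection as the failure of a cut.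

xor-true : ∀ {a b} → a ≢ b → a xor b ≡ true
xor-true {true}  {true}  a≢b = ⊥-elim (a≢b ≡.refl)
xor-true {true}  {false} a≢b = ≡.refl
xor-true {false} {true}  a≢b = ≡.refl
xor-true {false} {false} a≢b = ⊥-elim (a≢b ≡.refl)

xor-≡ : ∀ {a b} → a xor b ≡ true → a ≢ b
xor-≡ {true}  () ≡.refl
xor-≡ {false} () ≡.refl

module _ {n} (G : Graph n) where

  ∈-cutEdges⁺ : ∀ {S e} → lookup S (proj₁ (ends G e)) ≢ lookup S (proj₂ (ends G e)) →
                e ∈ cutEdges G S
  ∈-cutEdges⁺ {S} {e} differ =
    lookup⇒[]= e _ (≡.trans (lookup∘tabulate (crosses G S) e) (xor-true differ))

  ∈-cutEdges⁻ : ∀ {S e} → e ∈ cutEdges G S →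
                lookup S (proj₁ (ends G e)) ≢ lookup S (proj₂ (ends G e))
  ∈-cutEdges⁻ {S} {e} e∈ =
    xor-≡ (≡.trans (≡.sym (lookup∘tabulate (crosses G S) e)) ([]=⇒lookup e∈))

  -- A surviving edge cannot cross `S`, since all edges that do have failed; so a path of survivors
  -- stays on one side.
  constant-along : ∀ {S F} → cutEdges G S ⊆ F →
                   ∀ {u v} → EqClosure (Link (ends G) F) u v → lookup S u ≡ lookup S v
  constant-along {S} {F} δS⊆F = go
    where
    link : ∀ {u v} → Link (ends G) F u v → lookup S u ≡ lookup S v
    link (e , e∉F , ≡.refl) = decidable-stable (lookup S _ Bool.≟ lookup S _)
      (λ differ → e∉F (δS⊆F (∈-cutEdges⁺ {S} differ)))
    go : ∀ {u v} → EqClosure (Link (ends G) F) u v → lookup S u ≡ lookup S v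
    go Star.ε       = ≡.refl
    go (fwd l ◅ p)  = ≡.trans (link l) (go p)
    go (bwd l ◅ p)  = ≡.trans (≡.sym (link l)) (go p)

failedCut⇒disconnected : ∀ {n} (G : Graph n) {S F} → IsCut S → cutEdges G S ⊆ F → ¬ Connected G F
failedCut⇒disconnected {suc n} G {S} (0∈S , x , x∈∁S) δS⊆F connected =
  x∈∁p⇒x∉p x∈∁S (lookup⇒[]= x S
    (≡.trans (≡.sym (constant-along G {S} δS⊆F (connected zero x))) ([]=⇒lookup 0∈S)))

-- The cut is the surviving component of vertex zero, which meets the normalisation in `IsCut`. If
-- it were everything, any two vertices would be joined through vertex zero.
disconnected⇒failedCut : ∀ {n} (G : Graph (suc n)) {F} → ¬ Connected G F →
                         ∃ λ S → IsCut S × cutEdges G S ⊆ F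
disconnected⇒failedCut {n} G {F} disconnected = S , cut , δS⊆F
  where
  joined : ∀ v → Dec (EqClosure (Link (ends G) F) zero v)
  joined = joined? (ends G) F zero
  S : Subset (suc n)
  S = tabulate (does ∘ joined)
  lookup-S : ∀ v → lookup S v ≡ does (joined v)
  lookup-S = lookup∘tabulate (does ∘ joined)
  cut : IsCut S
  cut with any? (¬? ∘ joined)
  ... | yes (v , ¬joined) = lookup⇒[]= zero S (dec-true (joined zero) Star.ε) , v ,
        x∉p⇒x∈∁p λ v∈S → absurd (≡.trans (≡.sym ([]=⇒lookup v∈S))
          (≡.trans (lookup-S v) (dec-false (joined v) ¬joined)))
    where
    absurd : ¬ (true ≡ false)
    absurd ()
  ... | no  allJoined = ⊥-elim (disconnected λ u v →
        EqC.symmetric _ (to u) ◅◅ to v)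
    where
    to : ∀ v → EqClosure (Link (ends G) F) zero v
    to v = decidable-stable (joined v) (λ ¬joined → allJoined (v , ¬joined))
  δS⊆F : cutEdges G S ⊆ F
  δS⊆F {e} e∈ = decidable-stable (e ∈? F) λ e∉F → ∈-cutEdges⁻ G {S} e∈ (sameSide e∉F)
    where
    sameSide : e ∉ F → lookup S (proj₁ (ends G e)) ≡ lookup S (proj₂ (ends G e))
    sameSide e∉F = ≡.trans (lookup-S _) (≡.trans eq (≡.sym (lookup-S _)))
      where
      eq : does (joined (proj₁ (ends G e))) ≡ does (joined (proj₂ (ends G e)))
      eq with joined (proj₁ (ends G e))
      ... | yes p = ≡.sym (dec-true (joined _) (p ◅◅ fwd (e , e∉F , ≡.refl) ◅ Star.ε))
      ... | no ¬p = ≡.sym (dec-false (joined _) λ q → ¬p (q ◅◅ bwd (e , e∉F , ≡.refl) ◅ Star.ε))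

does-true : ∀ {P : Set} (d : Dec P) → does d ≡ true → P
does-true (yes p) _ = p

-- The first two Bonferroni inequalities for the failure probability.

module FailureProbability (ℝ : Reals) where
  open Reals ℝ
  open Reliability ℝ
  open OrderedField ℝ
  open Sums ℝ

  𝟙-mono : ∀ {a b} → (a ≡ true → b ≡ true) → 𝟙 a ≤ 𝟙 b
  𝟙-mono {false} {b} a⇒b = 0≤𝟙 b
  𝟙-mono {true}  {b} a⇒b with ≡.refl ← a⇒b ≡.refl = ≤-refl

  module _ (p : Carrier) where

    weight : ∀ {m} → Subset m → Carrier
    weight F = p ^ ∣ F ∣ * (1# - p) ^ ∣ ∁ F ∣

    -- Independence, one edge at a time: an edge outside `D` contributes `(1 - p) + p = 1`, an edge
    -- in `D` contributes `p`.
    subsetSum-⊆ : ∀ {m} (D : Subset m) → subsetSum (λ F → 𝟙 (does (D ⊆? F)) * weight F) ≈ p ^ ∣ D ∣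
    subsetSum-⊆ [] = ≈-trans (+-identityʳ _) (≈-trans (*-identityˡ _) (*-identityˡ _))
    subsetSum-⊆ {suc m} (outside ∷ D) = begin-equality
      subsetSum (λ F → 𝟙 (does (outside ∷ D ⊆? F)) * weight F)
        ≈⟨ subsetSum-suc {m} _ ⟩
      subsetSum (λ F → 𝟙 (does (D ⊆? F)) * (p ^ ∣ F ∣ * ((1# - p) * (1# - p) ^ ∣ ∁ F ∣))) +
        subsetSum (λ F → 𝟙 (does (D ⊆? F)) * (p * p ^ ∣ F ∣ * (1# - p) ^ ∣ ∁ F ∣))
        ≈⟨ sum-+ (allSubsets m) _ _ ⟨
      subsetSum (λ F → 𝟙 (does (D ⊆? F)) * (p ^ ∣ F ∣ * ((1# - p) * (1# - p) ^ ∣ ∁ F ∣)) +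
                       𝟙 (does (D ⊆? F)) * (p * p ^ ∣ F ∣ * (1# - p) ^ ∣ ∁ F ∣))
        ≈⟨ sum-cong (allSubsets m) (λ F → solve 4 (λ i p a b →
             i :* (a :* ((con (+ 1) :- p) :* b)) :+ i :* (p :* a :* b) := i :* (a :* b)) ≈-refl
             _ p _ _) ⟩
      subsetSum (λ F → 𝟙 (does (D ⊆? F)) * weight F)
        ≈⟨ subsetSum-⊆ D ⟩
      p ^ ∣ D ∣ ∎
    subsetSum-⊆ {suc m} (inside ∷ D) = begin-equality
      subsetSum (λ F → 𝟙 (does (inside ∷ D ⊆? F)) * weight F)
        ≈⟨ subsetSum-suc {m} _ ⟩
      subsetSum {m} (λ F → 0# * weight (outside ∷ F)) +
        subsetSum (λ F → 𝟙 (does (D ⊆? F)) * (p * p ^ ∣ F ∣ * (1# - p) ^ ∣ ∁ F ∣))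
        ≈⟨ sum-+ (allSubsets m) _ _ ⟨
      subsetSum {m} (λ F → 0# * weight (outside ∷ F) +
                       𝟙 (does (D ⊆? F)) * (p * p ^ ∣ F ∣ * (1# - p) ^ ∣ ∁ F ∣))
        ≈⟨ sum-cong (allSubsets m) (λ F → solve 5 (λ w i p a b →
             con (+ 0) :* w :+ i :* (p :* a :* b) := p :* (i :* (a :* b))) ≈-refl
             _ _ p _ _) ⟩
      subsetSum (λ F → p * (𝟙 (does (D ⊆? F)) * weight F))
        ≈⟨ *-sumˡ p (allSubsets m) _ ⟨
      p * subsetSum (λ F → 𝟙 (does (D ⊆? F)) * weight F)
        ≈⟨ *-congˡ (subsetSum-⊆ D) ⟩
      p * p ^ ∣ D ∣ ∎

  𝟙-∪⊆ : ∀ {m} (C D F : Subset m) →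
         𝟙 (does (C ⊆? F)) * 𝟙 (does (D ⊆? F)) ≈ 𝟙 (does (C ∪ D ⊆? F))
  𝟙-∪⊆ C D F with C ⊆? F | D ⊆? F
  ... | yes C⊆F | yes D⊆F = ≈-trans (*-identityˡ _)
        (≈-reflexive (≡.cong 𝟙 (≡.sym (dec-true (C ∪ D ⊆? F) ([ C⊆F , D⊆F ]′ ∘ x∈p∪q⁻ C D)))))
  ... | yes _   | no  D⊈F = ≈-trans (*-identityˡ _)
        (≈-reflexive (≡.cong 𝟙 (≡.sym (dec-false (C ∪ D ⊆? F) (λ h → D⊈F (h ∘ q⊆p∪q C D))))))
  ... | no  C⊈F | _       = ≈-trans (zeroˡ _)
        (≈-reflexive (≡.cong 𝟙 (≡.sym (dec-false (C ∪ D ⊆? F) (λ h → C⊈F (h ∘ p⊆p∪q D))))))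

  isCutᵇ : ∀ {n} → Subset n → Bool
  isCutᵇ = does ∘ isCut?

  cutSum : ∀ {n} → (Subset n → Carrier) → Carrier
  cutSum f = subsetSum λ S → 𝟙 (isCutᵇ S) * f S

  distinct : ∀ {n} → Subset n → Subset n → Carrier
  distinct S T = 𝟙 (not (does (T ≟ˢ S)))

  -- Pairs are ordered, so each unordered pair of distinct cuts counts twice; only upper bounds on
  -- their sum are at stake.
  cutPair : ∀ {n} → Subset n → Subset n → Carrier
  cutPair S T = 𝟙 (isCutᵇ S) * (distinct S T * 𝟙 (isCutᵇ T))

  module _ {n : ℕ} (G : Graph (suc n)) where

    private
      subsets = allSubsets (suc n)

    fails : Subset (suc n) → Subset (size G) → Carrier
    fails S F = 𝟙 (does (cutEdges G S ⊆? F))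

    disconnected : Subset (size G) → Carrier
    disconnected F = 𝟙 (does (¬? (connected? G F)))

    cutFails : Subset (size G) → Subset (suc n) → Carrier
    cutFails F S = 𝟙 (isCutᵇ S) * fails S F

    0≤cutFails : ∀ F S → 0# ≤ cutFails F S
    0≤cutFails F S = *-nonNegative (0≤𝟙 _) (0≤𝟙 _)

    cutFails≡1 : ∀ {F S} → IsCut S → cutEdges G S ⊆ F → cutFails F S ≈ 1#
    cutFails≡1 {F} {S} cut δS⊆F = ≈-trans
      (≈-reflexive (≡.cong₂ (λ a b → 𝟙 a * 𝟙 b) (dec-true (isCut? S) cut)
                                                 (dec-true (cutEdges G S ⊆? F) δS⊆F)))
      (*-identityˡ 1#)

    disconnected≤cutFails : ∀ F → disconnected F ≤ subsetSum (cutFails F)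
    disconnected≤cutFails F = go (connected? G F)
      where
      go : (d : Dec (Connected G F)) → 𝟙 (does (¬? d)) ≤ subsetSum (cutFails F)
      go (yes _) = sum-nonNegative subsets (0≤cutFails F)
      go (no ¬connected) with disconnected⇒failedCut G ¬connected
      ... | S , cut , δS⊆F = ≤-trans (≤-reflexive (≈-sym (cutFails≡1 cut δS⊆F)))
              (term≤sum (0≤cutFails F) (∈-allSubsets S))

    twoCutsFail : Subset (size G) → Subset (suc n) → Subset (suc n) → Carrier
    twoCutsFail F S T = cutFails F S * (distinct S T * cutFails F T)

    0≤twoCutsFail : ∀ F S T → 0# ≤ twoCutsFail F S T
    0≤twoCutsFail F S T =
      *-nonNegative (0≤cutFails F S) (*-nonNegative (0≤𝟙 _) (0≤cutFails F T))

    -- If no cut fails, the left side vanishes. Otherwise fix one failed cut `S₀`: it accounts for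
    -- the 1, and every further failed cut forms a pair with it, so the row of `S₀` in the double
    -- sum already suffices.
    cutFails≤ : ∀ F → subsetSum (cutFails F) ≤
                      disconnected F + subsetSum (λ S → subsetSum (twoCutsFail F S))
    cutFails≤ F = go (connected? G F)
      where
      go : (d : Dec (Connected G F)) → subsetSum (cutFails F) ≤
           𝟙 (does (¬? d)) + subsetSum (λ S → subsetSum (twoCutsFail F S))
      go (yes connected) = begin
        subsetSum (cutFails F)
          ≈⟨ sum-cong subsets (λ S → none S (isCut? S) (cutEdges G S ⊆? F)) ⟩
        subsetSum {suc n} (λ _ → 0#)
          ≈⟨ sum-0 subsets ⟩
        0#
          ≤⟨ +-nonNegative ≤-refl (sum-nonNegative subsets λ S →
               sum-nonNegative subsets (0≤twoCutsFail F S)) ⟩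
        0# + subsetSum (λ S → subsetSum (twoCutsFail F S)) ∎
        where
        none : ∀ S (d : Dec (IsCut S)) (d′ : Dec (cutEdges G S ⊆ F)) → 𝟙 (does d) * 𝟙 (does d′) ≈ 0#
        none S (no  _)   _           = zeroˡ _
        none S (yes _)   (no _)      = zeroʳ _
        none S (yes cut) (yes δS⊆F)  = ⊥-elim (failedCut⇒disconnected G cut δS⊆F connected)
      go (no ¬connected) with disconnected⇒failedCut G ¬connected
      ... | S₀ , cut , δS₀⊆F = begin
        subsetSum (cutFails F)
          ≈⟨ subsetSum-remove S₀ (cutFails F) ⟩
        cutFails F S₀ + subsetSum (λ T → distinct S₀ T * cutFails F T)
          ≈⟨ +-cong one (sum-cong subsets λ T →
               ≈-trans (≈-sym (*-identityˡ _)) (*-congʳ (≈-sym one))) ⟩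
        1# + subsetSum (twoCutsFail F S₀)
          ≤⟨ +-monoʳ-≤ 1# (term≤sum {f = λ S → subsetSum (twoCutsFail F S)}
               (λ S → sum-nonNegative subsets (0≤twoCutsFail F S)) (∈-allSubsets S₀)) ⟩
        1# + subsetSum (λ S → subsetSum (twoCutsFail F S)) ∎
        where one = cutFails≡1 cut δS₀⊆F

    module _ {p : Carrier} (0≤p : 0# ≤ p) (p≤1 : p ≤ 1#) where

      private
        edgeSets = allSubsets (size G)

      0≤weight : ∀ (F : Subset (size G)) → 0# ≤ weight p F
      0≤weight F = *-nonNegative (^-nonNegative ∣ F ∣ 0≤p) (^-nonNegative ∣ ∁ F ∣ (0≤-diff p≤1))

      FAIL≈ : FAIL G p ≈ subsetSum (λ F → disconnected F * weight p F)
      FAIL≈ = sum-filter (λ F → ¬? (connected? G F)) edgeSets (weight p)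

      -- Linearity of expectation for the number of failed cuts.
      cutSum≈ : subsetSum (λ F → subsetSum (cutFails F) * weight p F) ≈
                cutSum (λ S → p ^ cutValue G S)
      cutSum≈ = begin-equality
        subsetSum (λ F → subsetSum (cutFails F) * weight p F)
          ≈⟨ sum-cong edgeSets (λ F → *-sumʳ (weight p F) subsets _) ⟩
        subsetSum (λ F → subsetSum λ S → cutFails F S * weight p F)
          ≈⟨ sum-swap edgeSets subsets _ ⟩
        subsetSum (λ S → subsetSum λ F → cutFails F S * weight p F)
          ≈⟨ sum-cong subsets (λ S → ≈-trans
               (sum-cong edgeSets λ F → *-assoc (𝟙 (isCutᵇ S)) _ _)
               (≈-trans (≈-sym (*-sumˡ (𝟙 (isCutᵇ S)) edgeSets _))
                 (*-congˡ (subsetSum-⊆ p (cutEdges G S))))) ⟩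
        cutSum (λ S → p ^ cutValue G S) ∎

      FAIL≤cutSum : FAIL G p ≤ cutSum (λ S → p ^ cutValue G S)
      FAIL≤cutSum = begin
        FAIL G p
          ≈⟨ FAIL≈ ⟩
        subsetSum (λ F → disconnected F * weight p F)
          ≤⟨ sum-mono edgeSets (λ F → *-monoʳ-≤ (0≤weight F) (disconnected≤cutFails F)) ⟩
        subsetSum (λ F → subsetSum (cutFails F) * weight p F)
          ≈⟨ cutSum≈ ⟩
        cutSum (λ S → p ^ cutValue G S) ∎

      -- The expectation of `cutFails≤`. Two cuts both fail exactly when the union of their edges
      -- does, which brings in `jointValue`.
      cutSum≤FAIL+pairs : cutSum (λ S → p ^ cutValue G S) ≤
        FAIL G p + subsetSum (λ S → subsetSum λ T → cutPair S T * p ^ jointValue G S T)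
      cutSum≤FAIL+pairs = begin
        cutSum (λ S → p ^ cutValue G S)
          ≈⟨ cutSum≈ ⟨
        subsetSum (λ F → subsetSum (cutFails F) * weight p F)
          ≤⟨ sum-mono edgeSets (λ F → ≤-trans (*-monoʳ-≤ (0≤weight F) (cutFails≤ F))
               (≤-reflexive (distribʳ (weight p F) _ _))) ⟩
        subsetSum (λ F → disconnected F * weight p F +
                         subsetSum (λ S → subsetSum (twoCutsFail F S)) * weight p F)
          ≈⟨ sum-+ edgeSets _ _ ⟩
        subsetSum (λ F → disconnected F * weight p F) +
          subsetSum (λ F → subsetSum (λ S → subsetSum (twoCutsFail F S)) * weight p F)
          ≈⟨ +-cong (≈-sym FAIL≈) reorder ⟩
        FAIL G p + subsetSum (λ S → subsetSum λ T → cutPair S T * p ^ jointValue G S T) ∎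
        where
        regroup : ∀ S T F → twoCutsFail F S T * weight p F ≈
                  cutPair S T * (𝟙 (does (cutEdges G S ∪ cutEdges G T ⊆? F)) * weight p F)
        regroup S T F = ≈-trans
          (solve 6 (λ a b c d e w → a :* b :* (c :* (d :* e)) :* w
                       := a :* (c :* d) :* (b :* e :* w)) ≈-refl
             (𝟙 (isCutᵇ S)) (fails S F) (distinct S T) (𝟙 (isCutᵇ T)) (fails T F) (weight p F))
          (*-congˡ (*-congʳ (𝟙-∪⊆ (cutEdges G S) (cutEdges G T) F)))
        reorder : subsetSum (λ F → subsetSum (λ S → subsetSum (twoCutsFail F S)) * weight p F) ≈
                  subsetSum (λ S → subsetSum λ T → cutPair S T * p ^ jointValue G S T)
        reorder = begin-equality
          subsetSum (λ F → subsetSum (λ S → subsetSum (twoCutsFail F S)) * weight p F)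
            ≈⟨ sum-cong edgeSets (λ F → ≈-trans (*-sumʳ (weight p F) subsets _)
                 (sum-cong subsets λ S → *-sumʳ (weight p F) subsets _)) ⟩
          subsetSum (λ F → subsetSum λ S → subsetSum λ T → twoCutsFail F S T * weight p F)
            ≈⟨ sum-swap edgeSets subsets _ ⟩
          subsetSum (λ S → subsetSum λ F → subsetSum λ T → twoCutsFail F S T * weight p F)
            ≈⟨ sum-cong subsets (λ S → ≈-trans (sum-swap edgeSets subsets _)
                 (sum-cong subsets λ T → ≈-trans (sum-cong edgeSets (regroup S T))
                   (≈-trans (≈-sym (*-sumˡ (cutPair S T) edgeSets _))
                     (*-congˡ (subsetSum-⊆ p (cutEdges G S ∪ cutEdges G T)))))) ⟩
          subsetSum (λ S → subsetSum λ T → cutPair S T * p ^ jointValue G S T) ∎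

      cut≤FAIL : ∀ {S} → IsCut S → p ^ cutValue G S ≤ FAIL G p
      cut≤FAIL {S} cut = begin
        p ^ cutValue G S
          ≈⟨ subsetSum-⊆ p (cutEdges G S) ⟨
        subsetSum (λ F → fails S F * weight p F)
          ≤⟨ sum-mono edgeSets (λ F → *-monoʳ-≤ (0≤weight F) (fails≤disconnected F)) ⟩
        subsetSum (λ F → disconnected F * weight p F)
          ≈⟨ FAIL≈ ⟨
        FAIL G p ∎
        where
        fails≤disconnected : ∀ F → fails S F ≤ disconnected F
        fails≤disconnected F = 𝟙-mono λ δS⊆?F → dec-true (¬? (connected? G F))
          (failedCut⇒disconnected G cut (does-true (cutEdges G S ⊆? F) δS⊆?F))

-- The complement of the symmetric difference: as a cut it is the same, and it contains
-- vertex zero if S and T do.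
infixl 6 _⊖_
_⊖_ : ∀ {n} → Subset n → Subset n → Subset n
S ⊖ T = zipWith _xor_ (∁ S) T

⊖-comm : ∀ {n} (S T : Subset n) → S ⊖ T ≡ T ⊖ S
⊖-comm []      []      = ≡.refl
⊖-comm (a ∷ S) (b ∷ T) = ≡.cong₂ _∷_ bits (⊖-comm S T)
  where
  bits : not a xor b ≡ not b xor a
  bits = ≡.trans (≡.sym (not-distribˡ-xor a b))
    (≡.trans (≡.cong not (xor-comm a b)) (not-distribˡ-xor b a))

lookup-⊖ : ∀ {n} (S T : Subset n) i → lookup (S ⊖ T) i ≡ not (lookup S i) xor lookup T i
lookup-⊖ S T i = ≡.trans (lookup-zipWith _xor_ i (∁ S) T)
  (≡.cong (_xor lookup T i) (lookup-map i not S))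

-- Vertex zero belongs to both sets, and any vertex on which `S` and `T` disagree lies outside
-- `S ⊖ T`.
⊖-isCut : ∀ {n} {S T : Subset n} → IsCut S → IsCut T → T ≢ S → IsCut (S ⊖ T)
⊖-isCut {suc n} {S} {T} (0∈S , _) (0∈T , _) T≢S =
  lookup⇒[]= zero (S ⊖ T) (≡.trans (lookup-⊖ S T zero)
    (≡.cong₂ (λ a b → not a xor b) ([]=⇒lookup 0∈S) ([]=⇒lookup 0∈T))) , differing
  where
  differing : ∃ (_∈ ∁ (S ⊖ T))
  differing with any? (λ i → ¬? (lookup T i Bool.≟ lookup S i))
  ... | yes (i , T≢Sᵢ) = i , lookup⇒[]= i (∁ (S ⊖ T)) (≡.trans (lookup-map i not (S ⊖ T))
        (≡.trans (≡.cong not (lookup-⊖ S T i)) (lemma (lookup S i) (lookup T i) T≢Sᵢ)))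
    where
    lemma : ∀ a b → b ≢ a → not (not a xor b) ≡ true
    lemma true  true  b≢a = ⊥-elim (b≢a ≡.refl)
    lemma true  false b≢a = ≡.refl
    lemma false true  b≢a = ≡.refl
    lemma false false b≢a = ⊥-elim (b≢a ≡.refl)
  ... | no  same = ⊥-elim (T≢S (≡.trans (≡.sym (tabulate∘lookup T)) (≡.trans
        (tabulate-cong λ i → decidable-stable (lookup T i Bool.≟ lookup S i) λ ne → same (i , ne))
        (tabulate∘lookup S))))

crosses-⊖ : ∀ {n} (G : Graph n) S T e → crosses G (S ⊖ T) e ≡ crosses G S e xor crosses G T e
crosses-⊖ G S T e = ≡.trans (≡.cong₂ _xor_ (lookup-⊖ S T u) (lookup-⊖ S T v))
  (lemma (lookup S u) (lookup S v) (lookup T u) (lookup T v))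
  where
  u = proj₁ (ends G e)
  v = proj₂ (ends G e)
  lemma : ∀ a b c d → (not a xor c) xor (not b xor d) ≡ (a xor b) xor (c xor d)
  lemma true  true  c d = ≡.refl
  lemma true  false true  d = ≡.refl
  lemma true  false false d = ≡.refl
  lemma false true  true  true  = ≡.refl
  lemma false true  true  false = ≡.refl
  lemma false true  false true  = ≡.refl
  lemma false true  false false = ≡.refl
  lemma false false true  true  = ≡.refl
  lemma false false true  false = ≡.refl
  lemma false false false true  = ≡.refl
  lemma false false false false = ≡.refl

cutValue-∁ : ∀ {n} (G : Graph n) S → cutValue G (∁ S) ≡ cutValue G S
cutValue-∁ G S = ≡.cong ∣_∣ (tabulate-cong λ e → ≡.trans
  (≡.cong₂ _xor_ (lookup-map (proj₁ (ends G e)) not S) (lookup-map (proj₂ (ends G e)) not S))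
  (xor-annihilates-not (lookup S (proj₁ (ends G e))) _))

-- When vertex zero is not in `S`, the complement of `S` represents the same cut in normal form.
minCut⇒cutsAtLeast : ∀ {k c} (G : Graph (suc k)) → IsMinCutValue G c → CutsAtLeast c G
minCut⇒cutsAtLeast {c = c} G (_ , c≤) S {a} {b} Sa Sb with zero ∈? S
... | yes 0∈S = c≤ S (0∈S , b , lookup⇒[]= b (∁ S) (≡.trans (lookup-map b not S) (≡.cong not Sb)))
... | no  0∉S = ≡.subst (c ℕ.≤_) (cutValue-∁ G S)
      (c≤ (∁ S) (x∉p⇒x∈∁p 0∉S , a , x∉p⇒x∈∁p (x∈p⇒x∉∁p (lookup⇒[]= a S Sa))))

minCut≤size : ∀ {n c} (G : Graph n) → IsMinCutValue G c → c ℕ.≤ size G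
minCut≤size G ((S , _ , ≡.refl) , _) = ∣p∣≤n (cutEdges G S)

-- Bounding the pairs of cuts and the strong cuts.

module Approximation (ℝ : Reals) where
  open Reals ℝ
  open Reliability ℝ
  open OrderedField ℝ
  open Sums ℝ
  open CutCounting ℝ
  open CutGeneratingFunction ℝ
  open FailureProbability ℝ

  -- Every edge in the union crosses exactly two of the three cuts `S`, `T` and `S ⊖ T`; every other
  -- edge crosses none.
  twice-joint : ∀ {n} (G : Graph n) S T → fromℕ 2 * joint G S T ≈
                fromℕ (cutValue G S) + fromℕ (cutValue G T) + fromℕ (cutValue G (S ⊖ T))
  twice-joint G S T = begin-equality
    fromℕ 2 * joint G S T
      ≈⟨ *-congˡ (joint≈ G S T) ⟩
    fromℕ 2 * sumOver edges (λ e → 𝟙 (crosses G S e ∨ crosses G T e))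
      ≈⟨ *-sumˡ (fromℕ 2) edges _ ⟩
    sumOver edges (λ e → fromℕ 2 * 𝟙 (crosses G S e ∨ crosses G T e))
      ≈⟨ sum-cong edges (λ e → ≈-trans (inclusion-exclusion (crosses G S e) (crosses G T e))
           (+-congˡ (≈-reflexive (≡.cong 𝟙 (≡.sym (crosses-⊖ G S T e)))))) ⟩
    sumOver edges (λ e → 𝟙 (crosses G S e) + 𝟙 (crosses G T e) + 𝟙 (crosses G (S ⊖ T) e))
      ≈⟨ ≈-trans (sum-+ edges _ _) (+-congʳ (sum-+ edges _ _)) ⟩
    sumOver edges (𝟙 ∘ crosses G S) + sumOver edges (𝟙 ∘ crosses G T) +
      sumOver edges (𝟙 ∘ crosses G (S ⊖ T))
      ≈⟨ +-cong (+-cong (fromℕ-cutValue G S) (fromℕ-cutValue G T)) (fromℕ-cutValue G (S ⊖ T)) ⟨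
    fromℕ (cutValue G S) + fromℕ (cutValue G T) + fromℕ (cutValue G (S ⊖ T)) ∎
    where
    edges = allFin (size G)
    inclusion-exclusion : ∀ a b → fromℕ 2 * 𝟙 (a ∨ b) ≈ 𝟙 a + 𝟙 b + 𝟙 (a xor b)
    inclusion-exclusion true  true  = solve 0 (con (+ 2) :* con (+ 1)
         := con (+ 1) :+ con (+ 1) :+ con (+ 0)) ≈-refl
    inclusion-exclusion true  false = solve 0 (con (+ 2) :* con (+ 1)
         := con (+ 1) :+ con (+ 0) :+ con (+ 1)) ≈-refl
    inclusion-exclusion false true  = solve 0 (con (+ 2) :* con (+ 1)
         := con (+ 0) :+ con (+ 1) :+ con (+ 1)) ≈-refl
    inclusion-exclusion false false = solve 0 (con (+ 2) :* con (+ 0)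
         := con (+ 0) :+ con (+ 0) :+ con (+ 0)) ≈-refl

  -- AM-GM, in the form θ (u - θ′ v)² ≥ 0.
  am-gm : ∀ {θ θ′} u v → 0# ≤ θ → θ * θ′ ≈ 1# →
          fromℕ 2 * (u * v) ≤ θ * (u * u) + θ′ * (v * v)
  am-gm {θ} {θ′} u v 0≤θ θθ′≈1 = ≤-by (θ * ((u - θ′ * v) * (u - θ′ * v)))
    (*-nonNegative 0≤θ (0≤x*x _)) (begin-equality
      fromℕ 2 * (u * v) + θ * ((u - θ′ * v) * (u - θ′ * v))
        ≈⟨ solve 4 (λ θ θ′ u v →
             con (+ 2) :* (u :* v) :+ θ :* ((u :- θ′ :* v) :* (u :- θ′ :* v))
               := con (+ 2) :* (u :* v) :+ θ :* (u :* u) :- con (+ 2) :* (θ :* θ′ :* (u :* v)) :+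
                  θ :* θ′ :* (θ′ :* (v :* v))) ≈-refl θ θ′ u v ⟩
      fromℕ 2 * (u * v) + θ * (u * u) - fromℕ 2 * (θ * θ′ * (u * v)) + θ * θ′ * (θ′ * (v * v))
        ≈⟨ +-cong (+-congˡ (-‿cong (*-congˡ (*-congʳ θθ′≈1)))) (*-congʳ θθ′≈1) ⟩
      fromℕ 2 * (u * v) + θ * (u * u) - fromℕ 2 * (1# * (u * v)) + 1# * (θ′ * (v * v))
        ≈⟨ solve 4 (λ θ θ′ u v →
             con (+ 2) :* (u :* v) :+ θ :* (u :* u) :- con (+ 2) :* (con (+ 1) :* (u :* v)) :+
                  con (+ 1) :* (θ′ :* (v :* v)) := θ :* (u :* u) :+ θ′ :* (v :* v)) ≈-refl θ θ′ u v ⟩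
      θ * (u * u) + θ′ * (v * v) ∎)

  module Regime
    {k : ℕ} (G : Graph (suc k)) (c : ℕ) (minCut : IsMinCutValue G c)
    {p : Carrier} (0≤p : 0# ≤ p) (p≤1 : p ≤ 1#)
    {ℓ t δ : Carrier} (0≤ℓ : 0# ≤ ℓ) (0≤t : 0# ≤ t) (2≤δ : fromℕ 2 ≤ δ)
    (expℓ≈n : exp ℓ ≈ fromℕ (suc k)) (tc≈ℓ : t * fromℕ c ≈ ℓ)
    (p≈ : p ≈ exp (- ((fromℕ 2 + δ) * t)))
    where

    private
      subsets = allSubsets (suc k)

    value : Subset (suc k) → Carrier
    value S = fromℕ (cutValue G S)

    -- The power of `p` with exponent `x`, extended to field elements so that exponents can be split
    -- and compared.
    failure : Carrier → Carrier
    failure x = exp (- ((fromℕ 2 + δ) * t * x))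

    p^≈failure : ∀ x → p ^ x ≈ failure (fromℕ x)
    p^≈failure x = begin-equality
      p ^ x                                     ≈⟨ ^-congˡ x p≈ ⟩
      exp (- ((fromℕ 2 + δ) * t)) ^ x           ≈⟨ exp-^ _ x ⟩
      exp (fromℕ x * - ((fromℕ 2 + δ) * t))
        ≈⟨ exp-cong (solve 2 (λ x a → x :* :- a := :- (a :* x)) ≈-refl _ _) ⟩
      failure (fromℕ x)                         ∎

    term : Subset (suc k) → Carrier
    term S = 𝟙 (isCutᵇ S) * p ^ cutValue G S

    0≤term : ∀ S → 0# ≤ term S
    0≤term S = *-nonNegative (0≤𝟙 _) (^-nonNegative (cutValue G S) 0≤p)

    σ : Carrier
    σ = cutSum (λ S → p ^ cutValue G S)

    term-cut : ∀ S → IsCut S → failure (value S) ≈ term S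
    term-cut S cut = ≈-trans (≈-sym (p^≈failure (cutValue G S)))
      (≈-trans (≈-sym (*-identityˡ _)) (*-congʳ (≈-reflexive (≡.cong 𝟙 (≡.sym (dec-true (isCut? S) cut))))))

    cutsAtLeast : CutsAtLeast c G
    cutsAtLeast = minCut⇒cutsAtLeast G minCut

    pairSum≤K : subsetSum (λ S → subsetSum λ T → exp (- (fromℕ 2 * t * joint G S T))) ≤ K
    pairSum≤K = pairSum-exp≤K G cutsAtLeast (minCut≤size G minCut) 0≤ℓ 0≤t expℓ≈n tc≈ℓ

    -- As `δ ≥ 2`, the share `(1 + δ)tW` of the exponent is at least `3tW`, hence at least
    -- `tX + tY + tc`. The first two raise the coefficients of `X` and `Y` from `1 + δ` to `2 + δ`;
    -- the third is `ℓ`.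
    largest-dominates : ∀ {X Y W} → X ≤ W → Y ≤ W → fromℕ c ≤ W →
      exp (- ((1# + δ) * t * (X + Y + W))) ≤ exp (- ℓ) * (failure X * failure Y)
    largest-dominates {X} {Y} {W} X≤W Y≤W c≤W = begin
      exp (- ((1# + δ) * t * (X + Y + W)))
        ≤⟨ exp-mono (≤-by (t * ((δ - fromℕ 2) * W + (W - X) + (W - Y) + (W - fromℕ c)))
             (*-nonNegative 0≤t (+-nonNegative (+-nonNegative (+-nonNegative
               (*-nonNegative (0≤-diff 2≤δ) (≤-trans (0≤fromℕ c) c≤W))
               (0≤-diff X≤W)) (0≤-diff Y≤W)) (0≤-diff c≤W)))
             (≈-trans (solve 6 (λ t δ X Y W c →
                 :- ((con (+ 1) :+ δ) :* t :* (X :+ Y :+ W)) :+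
                   t :* ((δ :- con (+ 2)) :* W :+ (W :- X) :+ (W :- Y) :+ (W :- c))
                 := :- (t :* c) :+ (:- ((con (+ 2) :+ δ) :* t :* X) :+ :- ((con (+ 2) :+ δ) :* t :* Y)))
                 ≈-refl t δ X Y W (fromℕ c))
               (+-congʳ (-‿cong tc≈ℓ)))) ⟩
      exp (- ℓ + (- ((fromℕ 2 + δ) * t * X) + - ((fromℕ 2 + δ) * t * Y)))
        ≈⟨ ≈-trans (exp-+ _ _) (*-congˡ (exp-+ _ _)) ⟩
      exp (- ℓ) * (failure X * failure Y) ∎

    -- Whichever of the three is largest, the product for the other two is among the summands;
    -- taking all three avoids having to know which.
    three-cuts : ∀ {X Y W} → fromℕ c ≤ X → fromℕ c ≤ Y → fromℕ c ≤ W →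
      exp (- ((1# + δ) * t * (X + Y + W))) ≤
      exp (- ℓ) * (failure X * failure Y + failure X * failure W + failure Y * failure W)
    three-cuts {X} {Y} {W} c≤X c≤Y c≤W = go (total X Y) (total Y W) (total X W)
      where
      x = failure X
      y = failure Y
      w = failure W
      0≤xy : 0# ≤ x * y
      0≤xy = *-nonNegative (0≤exp _) (0≤exp _)
      0≤xw : 0# ≤ x * w
      0≤xw = *-nonNegative (0≤exp _) (0≤exp _)
      0≤yw : 0# ≤ y * w
      0≤yw = *-nonNegative (0≤exp _) (0≤exp _)
      weaken : ∀ {X′ Y′ W′ z} → X′ + Y′ + W′ ≈ X + Y + W →
        exp (- ((1# + δ) * t * (X′ + Y′ + W′))) ≤ exp (- ℓ) * z →
        z ≤ x * y + x * w + y * w →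
        exp (- ((1# + δ) * t * (X + Y + W))) ≤ exp (- ℓ) * (x * y + x * w + y * w)
      weaken eq h z≤ = ≤-trans (≤-reflexive (exp-cong (-‿cong (*-congˡ (≈-sym eq)))))
        (≤-trans h (*-monoˡ-≤ (0≤exp _) z≤))
      W-max : X ≤ W → Y ≤ W → _
      W-max X≤W Y≤W = weaken ≈-refl (largest-dominates X≤W Y≤W c≤W)
        (≤-by (x * w + y * w) (+-nonNegative 0≤xw 0≤yw) (≈-sym (+-assoc _ _ _)))
      Y-max : X ≤ Y → W ≤ Y → _
      Y-max X≤Y W≤Y = weaken (solve 3 (λ X Y W → X :+ W :+ Y := X :+ Y :+ W) ≈-refl X Y W)
        (largest-dominates X≤Y W≤Y c≤Y)
        (≤-by (x * y + y * w) (+-nonNegative 0≤xy 0≤yw)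
          (solve 3 (λ a b c → b :+ (a :+ c) := a :+ b :+ c) ≈-refl _ _ _))
      X-max : Y ≤ X → W ≤ X → _
      X-max Y≤X W≤X = weaken (solve 3 (λ X Y W → Y :+ W :+ X := X :+ Y :+ W) ≈-refl X Y W)
        (largest-dominates Y≤X W≤X c≤X)
        (≤-by (x * y + x * w) (+-nonNegative 0≤xy 0≤xw) (+-comm _ _))
      go : X ≤ Y ⊎ Y ≤ X → Y ≤ W ⊎ W ≤ Y → X ≤ W ⊎ W ≤ X → _
      go (inj₁ X≤Y) (inj₁ Y≤W) _          = W-max (≤-trans X≤Y Y≤W) Y≤W
      go (inj₁ X≤Y) (inj₂ W≤Y) _          = Y-max X≤Y W≤Y
      go (inj₂ Y≤X) _          (inj₁ X≤W) = W-max X≤W (≤-trans Y≤X X≤W)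
      go (inj₂ Y≤X) _          (inj₂ W≤X) = X-max Y≤X W≤X

    triangle : Subset (suc k) → Subset (suc k) → Carrier
    triangle S T = term S * term T + term S * term (S ⊖ T) + term T * term (S ⊖ T)

    0≤triangle : ∀ S T → 0# ≤ triangle S T
    0≤triangle S T = +-nonNegative (+-nonNegative (*-nonNegative (0≤term S) (0≤term T))
      (*-nonNegative (0≤term S) (0≤term (S ⊖ T)))) (*-nonNegative (0≤term T) (0≤term (S ⊖ T)))

    module _ {θ θ′ : Carrier} (0≤θ : 0# ≤ θ) (0≤θ′ : 0# ≤ θ′) (θθ′≈1 : θ * θ′ ≈ 1#) where

      -- Splitting `2 + δ` as `1 + (1 + δ)` makes the failure probability a product to which `am-gm`
      -- applies. The first square is a summand of `pairSum≤K`; the second has twice the joint value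
      -- in its exponent, so `twice-joint` and `three-cuts` take over.
      pair-bound : ∀ S T → fromℕ 2 * (cutPair S T * p ^ jointValue G S T) ≤
                   θ * exp (- (fromℕ 2 * t * joint G S T)) + θ′ * (exp (- ℓ) * triangle S T)
      pair-bound S T = go (isCut? S) (isCut? T) (T ≟ˢ S)
        where
        j = joint G S T
        0≤rhs : 0# ≤ θ * exp (- (fromℕ 2 * t * j)) + θ′ * (exp (- ℓ) * triangle S T)
        0≤rhs = +-nonNegative (*-nonNegative 0≤θ (0≤exp _))
          (*-nonNegative 0≤θ′ (*-nonNegative (0≤exp _) (0≤triangle S T)))
        vanish : ∀ {a} → a ≈ 0# → fromℕ 2 * (a * p ^ jointValue G S T) ≤
                 θ * exp (- (fromℕ 2 * t * j)) + θ′ * (exp (- ℓ) * triangle S T)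
        vanish a≈0 = ≤-trans (≤-reflexive (≈-trans (*-congˡ (≈-trans (*-congʳ a≈0) (zeroˡ _))) (zeroʳ _))) 0≤rhs
        least : ∀ U → IsCut U → fromℕ c ≤ value U
        least U cut = fromℕ-mono (proj₂ minCut U cut)
        go : (d : Dec (IsCut S)) (d′ : Dec (IsCut T)) (e : Dec (T ≡ S)) →
             fromℕ 2 * (𝟙 (does d) * (𝟙 (not (does e)) * 𝟙 (does d′)) * p ^ jointValue G S T) ≤
             θ * exp (- (fromℕ 2 * t * j)) + θ′ * (exp (- ℓ) * triangle S T)
        go (no  _)    _          _         = vanish (zeroˡ _)
        go (yes _)    (no  _)    e         = vanish (≈-trans (*-congˡ (zeroʳ _)) (zeroʳ _))
        go (yes _)    (yes _)    (yes _)   = vanish (≈-trans (*-congˡ (zeroˡ _)) (zeroʳ _))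
        go (yes cutS) (yes cutT) (no T≢S)  = begin
          fromℕ 2 * (1# * (1# * 1#) * p ^ jointValue G S T)
            ≈⟨ *-congˡ (≈-trans (solve 1 (λ x → con (+ 1) :* (con (+ 1) :* con (+ 1)) :* x
                 := x) ≈-refl _)
                 (p^≈failure (jointValue G S T))) ⟩
          fromℕ 2 * failure j
            ≈⟨ *-congˡ (≈-trans (exp-cong (solve 3 (λ δ t j →
                 :- ((con (+ 2) :+ δ) :* t :* j) := :- (t :* j) :+ :- ((con (+ 1) :+ δ) :* t :* j))
                      ≈-refl δ t j))
                 (exp-+ _ _)) ⟩
          fromℕ 2 * (exp (- (t * j)) * exp (- ((1# + δ) * t * j)))
            ≤⟨ am-gm _ _ 0≤θ θθ′≈1 ⟩
          θ * (exp (- (t * j)) * exp (- (t * j))) +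
            θ′ * (exp (- ((1# + δ) * t * j)) * exp (- ((1# + δ) * t * j)))
            ≈⟨ +-cong
                 (*-congˡ (≈-trans (≈-sym (exp-+ _ _)) (exp-cong
                   (solve 2 (λ t j → :- (t :* j) :+ :- (t :* j) := :- (con (+ 2) :* t :* j))
                        ≈-refl t j))))
                 (*-congˡ (≈-trans (≈-sym (exp-+ _ _)) (exp-cong (≈-trans
                   (solve 2 (λ a j → :- (a :* j) :+ :- (a :* j) := :- (a :* (con (+ 2) :* j)))
                        ≈-refl ((1# + δ) * t) j)
                   (-‿cong (*-congˡ (twice-joint G S T))))))) ⟩
          θ * exp (- (fromℕ 2 * t * j)) +
            θ′ * exp (- ((1# + δ) * t * (value S + value T + value (S ⊖ T))))
            ≤⟨ +-monoʳ-≤ _ (*-monoˡ-≤ 0≤θ′ (three-cuts (least S cutS) (least T cutT) (least (S ⊖ T) cut⊖))) ⟩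
          θ * exp (- (fromℕ 2 * t * j)) + θ′ * (exp (- ℓ) *
            (failure (value S) * failure (value T) + failure (value S) * failure (value (S ⊖ T)) +
             failure (value T) * failure (value (S ⊖ T))))
            ≈⟨ +-congˡ (*-congˡ (*-congˡ (+-cong (+-cong
                 (*-cong (term-cut S cutS) (term-cut T cutT))
                 (*-cong (term-cut S cutS) (term-cut (S ⊖ T) cut⊖)))
                 (*-cong (term-cut T cutT) (term-cut (S ⊖ T) cut⊖))))) ⟩
          θ * exp (- (fromℕ 2 * t * j)) + θ′ * (exp (- ℓ) * triangle S T) ∎
          where
          cut⊖ : IsCut (S ⊖ T)
          cut⊖ = ⊖-isCut cutS cutT T≢S

      term*σ : ∀ S → term S * subsetSum (λ T → term (S ⊖ T)) ≈ term S * σ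
      term*σ S = *-congˡ (subsetSum-xor (∁ S) term)

      ∑term*σ : subsetSum (λ S → term S * σ) ≈ σ * σ
      ∑term*σ = ≈-sym (*-sumʳ σ subsets term)

      -- Any two of `S`, `T` and `S ⊖ T` determine the third. So with one of them fixed, `S ⊖ T`
      -- runs over all subsets, and each of the three products sums to `σ * σ`.
      triangleSum : subsetSum (λ S → subsetSum (triangle S)) ≈ fromℕ 3 * (σ * σ)
      triangleSum = begin-equality
        subsetSum (λ S → subsetSum (triangle S))
          ≈⟨ sum-cong subsets (λ S → ≈-trans (sum-+ subsets _ _) (+-congʳ (sum-+ subsets _ _))) ⟩
        subsetSum (λ S → subsetSum (λ T → term S * term T) + subsetSum (λ T → term S * term (S ⊖ T)) +
                         subsetSum (λ T → term T * term (S ⊖ T)))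
          ≈⟨ ≈-trans (sum-+ subsets _ _) (+-congʳ (sum-+ subsets _ _)) ⟩
        subsetSum (λ S → subsetSum λ T → term S * term T) +
          subsetSum (λ S → subsetSum λ T → term S * term (S ⊖ T)) +
          subsetSum (λ S → subsetSum λ T → term T * term (S ⊖ T))
          ≈⟨ +-cong (+-cong
               (≈-trans (sum-cong subsets λ S → ≈-sym (*-sumˡ (term S) subsets term)) ∑term*σ)
               (≈-trans (sum-cong subsets λ S → ≈-trans (≈-sym (*-sumˡ (term S) subsets _)) (term*σ S)) ∑term*σ))
               (≈-trans (sum-swap subsets subsets _) (≈-trans (sum-cong subsets λ T →
                  ≈-trans (sum-cong subsets λ S → *-congˡ (≈-reflexive (≡.cong term (⊖-comm S T))))
                  (≈-trans (≈-sym (*-sumˡ (term T) subsets _)) (term*σ T))) ∑term*σ)) ⟩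
        σ * σ + σ * σ + σ * σ
          ≈⟨ solve 1 (λ x → x :+ x :+ x := con (+ 3) :* x) ≈-refl (σ * σ) ⟩
        fromℕ 3 * (σ * σ) ∎

      pairSum-bound :
        fromℕ 2 * subsetSum (λ S → subsetSum λ T → cutPair S T * p ^ jointValue G S T) ≤
        θ * K + θ′ * (exp (- ℓ) * (fromℕ 3 * (σ * σ)))
      pairSum-bound = begin
        fromℕ 2 * subsetSum (λ S → subsetSum λ T → cutPair S T * p ^ jointValue G S T)
          ≈⟨ *-pairSumˡ (fromℕ 2) _ ⟩
        subsetSum (λ S → subsetSum λ T → fromℕ 2 * (cutPair S T * p ^ jointValue G S T))
          ≤⟨ sum-mono subsets (λ S → sum-mono subsets (pair-bound S)) ⟩
        subsetSum (λ S → subsetSum λ T →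
          θ * exp (- (fromℕ 2 * t * joint G S T)) + θ′ * (exp (- ℓ) * triangle S T))
          ≈⟨ ≈-trans (sum-cong subsets λ S → sum-+ subsets _ _) (sum-+ subsets _ _) ⟩
        subsetSum (λ S → subsetSum λ T → θ * exp (- (fromℕ 2 * t * joint G S T))) +
          subsetSum (λ S → subsetSum λ T → θ′ * (exp (- ℓ) * triangle S T))
          ≈⟨ +-cong (*-pairSumˡ θ _) (≈-trans (*-congˡ (*-pairSumˡ (exp (- ℓ)) _)) (*-pairSumˡ θ′ _)) ⟨
        θ * subsetSum (λ S → subsetSum λ T → exp (- (fromℕ 2 * t * joint G S T))) +
          θ′ * (exp (- ℓ) * subsetSum (λ S → subsetSum (triangle S)))
          ≤⟨ +-mono-≤ (*-monoˡ-≤ 0≤θ pairSum≤K) (≤-reflexive (*-congˡ (*-congˡ triangleSum))) ⟩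
        θ * K + θ′ * (exp (- ℓ) * (fromℕ 3 * (σ * σ))) ∎
        where
        *-pairSumˡ : ∀ a (f : Subset (suc k) → Subset (suc k) → Carrier) →
          a * subsetSum (λ S → subsetSum (f S)) ≈ subsetSum (λ S → subsetSum λ T → a * f S T)
        *-pairSumˡ a f = ≈-trans (*-sumˡ a subsets _) (sum-cong subsets λ S → *-sumˡ a subsets (f S))

    module _ {ε₀ : Carrier} (0<ε₀ : 0# < ε₀) (0<ℓ : 0# < ℓ) (ℓ≡ln : ℓ ≡ ln (fromℕ (suc k))) where

      weakᵇ : Subset (suc k) → Bool
      weakᵇ S = does (isαMinimum? G c (weakα (suc k) δ ε₀) S)

      weakCutSum≈ : weakCutSum G c δ ε₀ p ≈ subsetSum (λ S → 𝟙 (isCutᵇ S) * (𝟙 (weakᵇ S) * p ^ cutValue G S))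
      weakCutSum≈ = ≈-trans (sum-filter (isαMinimum? G c (weakα (suc k) δ ε₀)) (cuts (suc k)) _)
        (sum-filter isCut? subsets _)

      weakCutSum≤σ : weakCutSum G c δ ε₀ p ≤ σ
      weakCutSum≤σ = ≤-trans (≤-reflexive weakCutSum≈) (sum-mono subsets λ S →
        *-monoˡ-≤ (0≤𝟙 (isCutᵇ S)) (≤-trans
          (*-monoʳ-≤ (^-nonNegative (cutValue G S) 0≤p) (𝟙≤1 (weakᵇ S))) (≤-reflexive (*-identityˡ _))))

      0<δ : 0# < δ
      0<δ = begin-strict
        0#       <⟨ 0<2 ⟩
        fromℕ 2  ≤⟨ 2≤δ ⟩
        δ        ∎

      -- This is the purpose of the threshold `α`: it makes `exp (- (δ * ℓ * α))` equal to `ε₀`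
      -- times the failure probability of a minimum cut.
      δℓα : δ * ℓ * weakα (suc k) δ ε₀ ≈ (fromℕ 2 + δ) * ℓ - ln ε₀
      δℓα = begin-equality
        δ * ℓ * (1# + fromℕ 2 / δ - ln ε₀ / (δ * ln (fromℕ (suc k))))
          ≡⟨ ≡.cong (λ l → δ * ℓ * (1# + fromℕ 2 / δ - ln ε₀ / (δ * l))) ℓ≡ln ⟨
        δ * ℓ * (1# + fromℕ 2 / δ - ln ε₀ / (δ * ℓ))
          ≈⟨ solve 4 (λ δ ℓ a b → δ :* ℓ :* (con (+ 1) :+ a :- b)
               := δ :* ℓ :+ a :* δ :* ℓ :- b :* (δ :* ℓ)) ≈-refl
               δ ℓ (fromℕ 2 / δ) (ln ε₀ / (δ * ℓ)) ⟩
        δ * ℓ + fromℕ 2 / δ * δ * ℓ - ln ε₀ / (δ * ℓ) * (δ * ℓ)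
          ≈⟨ +-cong (+-congˡ (*-congʳ (/-cancelʳ (fromℕ 2) 0<δ))) (-‿cong (/-cancelʳ (ln ε₀) (*-positive 0<δ 0<ℓ))) ⟩
        δ * ℓ + fromℕ 2 * ℓ - ln ε₀
          ≈⟨ solve 3 (λ δ ℓ e → δ :* ℓ :+ con (+ 2) :* ℓ :- e := (con (+ 2) :+ δ) :* ℓ :- e)
               ≈-refl δ ℓ (ln ε₀) ⟩
        (fromℕ 2 + δ) * ℓ - ln ε₀ ∎

      -- Of the exponent `(2 + δ)tx`, the part `2tx` is kept for summation by `K`; the part `δtx` is
      -- at least `δtαc`, that is `δℓα`.
      strong-bound : ∀ {x} → weakα (suc k) δ ε₀ * fromℕ c ≤ x →
                     failure x ≤ ε₀ * failure (fromℕ c) * exp (- (fromℕ 2 * t * x))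
      strong-bound {x} αc≤x = begin
        failure x
          ≤⟨ exp-mono (≤-by (δ * t * (x - α * fromℕ c))
               (*-nonNegative (*-nonNegative (<⇒≤ 0<δ) 0≤t) (0≤-diff αc≤x)) exponent) ⟩
        exp (ln ε₀ + - ((fromℕ 2 + δ) * t * fromℕ c) + - (fromℕ 2 * t * x))
          ≈⟨ ≈-trans (exp-+ _ _) (*-congʳ (≈-trans (exp-+ _ _) (*-congʳ (exp-ln 0<ε₀)))) ⟩
        ε₀ * failure (fromℕ c) * exp (- (fromℕ 2 * t * x)) ∎
        where
        α = weakα (suc k) δ ε₀
        exponent : - ((fromℕ 2 + δ) * t * x) + δ * t * (x - α * fromℕ c) ≈
                   ln ε₀ + - ((fromℕ 2 + δ) * t * fromℕ c) + - (fromℕ 2 * t * x)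
        exponent = begin-equality
          - ((fromℕ 2 + δ) * t * x) + δ * t * (x - α * fromℕ c)
            ≈⟨ solve 5 (λ δ t x α c →
                 :- ((con (+ 2) :+ δ) :* t :* x) :+ δ :* t :* (x :- α :* c)
                   := :- (δ :* (t :* c) :* α) :- con (+ 2) :* t :* x) ≈-refl δ t x α (fromℕ c) ⟩
          - (δ * (t * fromℕ c) * α) - fromℕ 2 * t * x
            ≈⟨ +-congʳ (-‿cong (≈-trans (*-congʳ (*-congˡ tc≈ℓ)) δℓα)) ⟩
          - ((fromℕ 2 + δ) * ℓ - ln ε₀) - fromℕ 2 * t * x
            ≈⟨ +-congʳ (-‿cong (+-congʳ (*-congˡ tc≈ℓ))) ⟨
          - ((fromℕ 2 + δ) * (t * fromℕ c) - ln ε₀) - fromℕ 2 * t * x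
            ≈⟨ solve 5 (λ δ t c e y → :- ((con (+ 2) :+ δ) :* (t :* c) :- e) :- y
                 := e :+ :- ((con (+ 2) :+ δ) :* t :* c) :+ :- y)
                      ≈-refl δ t (fromℕ c) (ln ε₀) (fromℕ 2 * t * x) ⟩
          ln ε₀ + - ((fromℕ 2 + δ) * t * fromℕ c) + - (fromℕ 2 * t * x) ∎

      -- The strong cuts are summed with `strong-bound`; the single sum that arises is the diagonal
      -- `T = S` of the pair sum bounded by `K`.
      σ≤weakCutSum+ : σ ≤ weakCutSum G c δ ε₀ p + ε₀ * failure (fromℕ c) * K
      σ≤weakCutSum+ = begin
        σ
          ≤⟨ sum-mono subsets split ⟩
        subsetSum (λ S → 𝟙 (isCutᵇ S) * (𝟙 (weakᵇ S) * p ^ cutValue G S) + A * decay S)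
          ≈⟨ sum-+ subsets _ _ ⟩
        subsetSum (λ S → 𝟙 (isCutᵇ S) * (𝟙 (weakᵇ S) * p ^ cutValue G S)) + subsetSum (λ S → A * decay S)
          ≈⟨ +-cong weakCutSum≈ (*-sumˡ A subsets decay) ⟨
        weakCutSum G c δ ε₀ p + A * subsetSum decay
          ≤⟨ +-monoʳ-≤ _ (*-monoˡ-≤ 0≤A (≤-trans (sum-mono subsets diagonal) pairSum≤K)) ⟩
        weakCutSum G c δ ε₀ p + A * K ∎
        where
        A = ε₀ * failure (fromℕ c)
        0≤A : 0# ≤ A
        0≤A = *-nonNegative (<⇒≤ 0<ε₀) (0≤exp _)
        decay : Subset (suc k) → Carrier
        decay S = exp (- (fromℕ 2 * t * value S))
        diagonal : ∀ S → decay S ≤ subsetSum (λ T → exp (- (fromℕ 2 * t * joint G S T)))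
        diagonal S = ≤-trans
          (≤-reflexive (≈-reflexive (≡.cong (λ C → exp (- (fromℕ 2 * t * fromℕ ∣ C ∣)))
            (≡.sym (∪-idem (cutEdges G S))))))
          (term≤sum {f = λ T → exp (- (fromℕ 2 * t * joint G S T))} (λ T → 0≤exp _) (∈-allSubsets S))
        split : ∀ S → term S ≤ 𝟙 (isCutᵇ S) * (𝟙 (weakᵇ S) * p ^ cutValue G S) + A * decay S
        split S with isαMinimum? G c (weakα (suc k) δ ε₀) S
        ... | yes _ = ≤-by (A * decay S) (*-nonNegative 0≤A (0≤exp _)) (+-congʳ (*-congˡ (≈-sym (*-identityˡ _))))
        ... | no  strong = begin
          term S
            ≤⟨ *-monoʳ-≤ (^-nonNegative (cutValue G S) 0≤p) (𝟙≤1 (isCutᵇ S)) ⟩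
          1# * p ^ cutValue G S
            ≈⟨ ≈-trans (*-identityˡ _) (p^≈failure (cutValue G S)) ⟩
          failure (value S)
            ≤⟨ strong-bound (≰⇒≥ strong) ⟩
          A * decay S
            ≈⟨ solve 3 (λ a x y → y := a :* (con (+ 0) :* x) :+ y)
                 ≈-refl (𝟙 (isCutᵇ S)) (p ^ cutValue G S) (A * decay S) ⟩
          𝟙 (isCutᵇ S) * (0# * p ^ cutValue G S) + A * decay S ∎

      minCut≤FAIL : failure (fromℕ c) ≤ FAIL G p
      minCut≤FAIL with proj₁ minCut
      ... | S , cut , ≡.refl = ≤-trans (≤-reflexive (≈-sym (p^≈failure (cutValue G S)))) (cut≤FAIL G 0≤p p≤1 cut)

      -- `FAIL` is at most `σ`, and the strong cuts missing from the weak sum contribute at most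
      -- `ε₀ * K` times `failure (fromℕ c)`, which `minCut≤FAIL` turns into a relative error.
      lower : ∀ {η} → ε₀ * K ≤ η → (1# - η) * FAIL G p ≤ weakCutSum G c δ ε₀ p
      lower {η} ε₀K≤η = begin
        (1# - η) * FAIL G p
          ≈⟨ solve 2 (λ η f → (con (+ 1) :- η) :* f := f :- η :* f) ≈-refl η (FAIL G p) ⟩
        FAIL G p - η * FAIL G p
          ≤⟨ +-mono-≤ (≤-trans (FAIL≤cutSum G 0≤p p≤1) σ≤weakCutSum+) (neg-antimono-≤ (begin
               ε₀ * failure (fromℕ c) * K
                 ≈⟨ solve 3 (λ a b c → a :* b :* c := a :* c :* b) ≈-refl _ _ _ ⟩
               ε₀ * K * failure (fromℕ c)
                 ≤⟨ *-mono-≤ (*-nonNegative (<⇒≤ 0<ε₀) (<⇒≤ 0<K)) (≤-trans (0≤exp _) minCut≤FAIL) ε₀K≤η minCut≤FAIL ⟩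
               η * FAIL G p ∎)) ⟩
        weakCutSum G c δ ε₀ p + A - A
          ≈⟨ solve 2 (λ w a → w :+ a :- a := w) ≈-refl (weakCutSum G c δ ε₀ p) A ⟩
        weakCutSum G c δ ε₀ p ∎
        where A = ε₀ * failure (fromℕ c) * K

      -- The weak sum is at most `σ`. Once pairs of cuts contribute at most `γ * σ`, `(1# - γ) * σ`
      -- is at most `FAIL`, and `1# + η` is the inverse of `1# - γ`.
      upper : ∀ {η γ} → 0# < η → 0# < γ → (1# + η) * (1# - γ) ≈ 1# →
              fromℕ 3 * K * exp (- ℓ) ≤ γ * γ →
              weakCutSum G c δ ε₀ p ≤ (1# + η) * FAIL G p
      upper {η} {γ} 0<η 0<γ γ-def large = begin
        weakCutSum G c δ ε₀ p
          ≤⟨ weakCutSum≤σ ⟩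
        σ
          ≈⟨ ≈-trans (*-congʳ γ-def) (*-identityˡ σ) ⟨
        (1# + η) * (1# - γ) * σ
          ≈⟨ solve 3 (λ η γ s → (con (+ 1) :+ η) :* (con (+ 1) :- γ) :* s := (con (+ 1) :+ η) :* (s :- γ :* s))
               ≈-refl η γ σ ⟩
        (1# + η) * (σ - γ * σ)
          ≤⟨ *-monoˡ-≤ (+-nonNegative 0≤1 (<⇒≤ 0<η)) (+-mono-≤ (cutSum≤FAIL+pairs G 0≤p p≤1) (neg-antimono-≤ pairs≤γσ)) ⟩
        (1# + η) * (FAIL G p + P - P)
          ≈⟨ *-congˡ (solve 2 (λ f p → f :+ p :- p := f) ≈-refl (FAIL G p) P) ⟩
        (1# + η) * FAIL G p ∎
        where
        P = subsetSum (λ S → subsetSum λ T → cutPair S T * p ^ jointValue G S T)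
        0<σ : 0# < σ
        0<σ = begin-strict
          0#                   <⟨ 0<exp _ ⟩
          failure (fromℕ c)    ≤⟨ minCut≤FAIL ⟩
          FAIL G p             ≤⟨ FAIL≤cutSum G 0≤p p≤1 ⟩
          σ                    ∎
        -- Chosen so that `θ * K` is `γ * σ`; the other term of `pairSum-bound` becomes
        -- `3Kσ exp (- ℓ) / γ`, at most `γ * σ` by `large`.
        θ  = σ * (γ * K ⁻¹)
        θ′ = σ ⁻¹ * (γ ⁻¹ * K)
        θθ′≈1 : θ * θ′ ≈ 1#
        θθ′≈1 = begin-equality
          σ * (γ * K ⁻¹) * (σ ⁻¹ * (γ ⁻¹ * K))
            ≈⟨ solve 6 (λ a b c d e f → a :* (b :* f) :* (c :* (d :* e))
                 := (a :* c) :* ((b :* d) :* (e :* f))) ≈-refl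
                 σ γ (σ ⁻¹) (γ ⁻¹) K (K ⁻¹) ⟩
          σ * σ ⁻¹ * (γ * γ ⁻¹ * (K * K ⁻¹))
            ≈⟨ *-cong (*-inverseʳ (0<⇒≉0 0<σ)) (*-cong (*-inverseʳ (0<⇒≉0 0<γ)) (*-inverseʳ (0<⇒≉0 0<K))) ⟩
          1# * (1# * 1#)
            ≈⟨ ≈-trans (*-identityˡ _) (*-identityˡ _) ⟩
          1# ∎
        0≤θ : 0# ≤ θ
        0≤θ = <⇒≤ (*-positive 0<σ (*-positive 0<γ (⁻¹-positive 0<K)))
        0≤θ′ : 0# ≤ θ′
        0≤θ′ = <⇒≤ (*-positive (⁻¹-positive 0<σ) (*-positive (⁻¹-positive 0<γ) 0<K))
        pairs≤γσ : P ≤ γ * σ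
        pairs≤γσ = *-cancelˡ-≤ 0<2 (begin
          fromℕ 2 * P
            ≤⟨ pairSum-bound 0≤θ 0≤θ′ θθ′≈1 ⟩
          θ * K + θ′ * (exp (- ℓ) * (fromℕ 3 * (σ * σ)))
            ≈⟨ solve 7 (λ σ σ⁻¹ γ γ⁻¹ K K⁻¹ e →
                 σ :* (γ :* K⁻¹) :* K :+ σ⁻¹ :* (γ⁻¹ :* K) :* (e :* (con (+ 3) :* (σ :* σ)))
                   := K⁻¹ :* K :* (γ :* σ) :+ σ⁻¹ :* σ :* (γ⁻¹ :* σ :* (con (+ 3) :* K :* e))) ≈-refl
                 σ (σ ⁻¹) γ (γ ⁻¹) K (K ⁻¹) (exp (- ℓ)) ⟩
          K ⁻¹ * K * (γ * σ) + σ ⁻¹ * σ * (γ ⁻¹ * σ * (fromℕ 3 * K * exp (- ℓ)))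
            ≈⟨ +-cong (*-congʳ (*-inverseˡ 0<K)) (*-congʳ (*-inverseˡ 0<σ)) ⟩
          1# * (γ * σ) + 1# * (γ ⁻¹ * σ * (fromℕ 3 * K * exp (- ℓ)))
            ≤⟨ +-monoʳ-≤ _ (*-monoˡ-≤ 0≤1 (*-monoˡ-≤ (<⇒≤ (*-positive (⁻¹-positive 0<γ) 0<σ)) large)) ⟩
          1# * (γ * σ) + 1# * (γ ⁻¹ * σ * (γ * γ))
            ≈⟨ solve 3 (λ σ γ γ⁻¹ → con (+ 1) :* (γ :* σ) :+ con (+ 1) :* (γ⁻¹ :* σ :* (γ :* γ))
                 := γ :* σ :+ γ⁻¹ :* γ :* (γ :* σ)) ≈-refl σ γ (γ ⁻¹) ⟩
          γ * σ + γ ⁻¹ * γ * (γ * σ)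
            ≈⟨ +-congˡ (*-congʳ (*-inverseˡ 0<γ)) ⟩
          γ * σ + 1# * (γ * σ)
            ≈⟨ solve 1 (λ x → x :+ con (+ 1) :* x := con (+ 2) :* x) ≈-refl (γ * σ) ⟩
          fromℕ 2 * (γ * σ) ∎)

-- The asymptotic statement: thresholds for `n` and the choice of `t`.

theorem5p1 : (ℝ : Reals) →
    let open Reals ℝ
        open Reliability ℝ
    in
    (ε : ℕ → Carrier) → (∀ n → 0# < ε n) → TendsToZero ε →
    ∀ η → 0# < η →
    ∃ λ N → ∀ n → N ℕ.≤ n →
    (G : Graph n) (c : ℕ) → IsMinCutValue G c →
    ∀ p → 0# < p → p < 1# →
    ∀ δ → p ^ c ≈ fromℕ n ^ʳ (- (fromℕ 2 + δ)) →
    (p ^ c < fromℕ n ^ʳ (- fromℕ 4) ⊎ FAIL G p < fromℕ n ^ʳ (- fromℕ 4)) →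
    (1# - η) * FAIL G p ≤ weakCutSum G c δ (ε n) p ×
    weakCutSum G c δ (ε n) p ≤ (1# + η) * FAIL G p
-- The 2 ensures `ln n > 0`, `N₁` ensures `ε n * K ≤ η`, and `N₂` ensures `3K/n ≤ γ * γ`; none
-- depends on the graph.
theorem5p1 ℝ ε 0<ε ε→0 η 0<η = 2 ℕ.+ N₁ ℕ.+ N₂ , main
  where
  open Reals ℝ
  open Reliability ℝ
  open OrderedField ℝ
  open CutGeneratingFunction ℝ
  open FailureProbability ℝ
  open Approximation ℝ

  ε-small : ∃ λ N → ∀ n → N ℕ.≤ n → - (η / K) ≤ ε n × ε n ≤ η / K
  ε-small = ε→0 (η / K) (*-positive 0<η (⁻¹-positive 0<K))
  N₁ = proj₁ ε-small

  0<1+η : 0# < 1# + η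
  0<1+η = +-positive 0<1 (<⇒≤ 0<η)

  γ : Carrier
  γ = η / (1# + η)

  0<γ : 0# < γ
  0<γ = *-positive 0<η (⁻¹-positive 0<1+η)

  γ-def : (1# + η) * (1# - γ) ≈ 1#
  γ-def = begin-equality
    (1# + η) * (1# - γ)
      ≈⟨ solve 2 (λ η γ → (con (+ 1) :+ η) :* (con (+ 1) :- γ)
           := con (+ 1) :+ η :- γ :* (con (+ 1) :+ η)) ≈-refl η γ ⟩
    1# + η - γ * (1# + η)    ≈⟨ +-congˡ (-‿cong (/-cancelʳ η 0<1+η)) ⟩
    1# + η - η               ≈⟨ solve 1 (λ η → con (+ 1) :+ η :- η := con (+ 1)) ≈-refl η ⟩
    1#                       ∎

  n-large = archimedean (fromℕ 3 * K / (γ * γ))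
  N₂ = proj₁ n-large

  main : ∀ n → 2 ℕ.+ N₁ ℕ.+ N₂ ℕ.≤ n → (G : Graph n) (c : ℕ) → IsMinCutValue G c →
    ∀ p → 0# < p → p < 1# →
    ∀ δ → p ^ c ≈ fromℕ n ^ʳ (- (fromℕ 2 + δ)) →
    (p ^ c < fromℕ n ^ʳ (- fromℕ 4) ⊎ FAIL G p < fromℕ n ^ʳ (- fromℕ 4)) →
    (1# - η) * FAIL G p ≤ weakCutSum G c δ (ε n) p ×
    weakCutSum G c δ (ε n) p ≤ (1# + η) * FAIL G p
  main (suc zero) (ℕ.s≤s ())
  main n@(suc (suc k)) N≤n G c minCut p 0<p p<1 δ p^c≈ smallness =
    lower (0<ε n) 0<ℓ ≡.refl ε-bound , upper (0<ε n) 0<ℓ ≡.refl 0<η 0<γ γ-def γ-bound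
    where
    ℓ = ln (fromℕ n)
    expℓ≈n : exp ℓ ≈ fromℕ n
    expℓ≈n = exp-ln (0<fromℕ (suc k))

    0<ℓ : 0# < ℓ
    0<ℓ = exp-cancel-< (begin-strict
      exp 0#            ≈⟨ exp-0 ⟩
      1#                ≈⟨ +-identityʳ 1# ⟨
      1# + 0#           <⟨ +-mono-<ʳ (0<fromℕ k) ⟩
      fromℕ n           ≈⟨ expℓ≈n ⟨
      exp ℓ             ∎)
      where
      +-mono-<ʳ : ∀ {x} → 0# < x → 1# + 0# < 1# + x
      +-mono-<ʳ {x} 0<x = ≰⇒> λ 1+x≤1+0 → <⇒≱ 0<x (begin
        x                 ≈⟨ solve 1 (λ x → x := con (+ 1) :+ x :- con (+ 1)) ≈-refl x ⟩
        1# + x - 1#       ≤⟨ +-monoˡ-≤ (- 1#) 1+x≤1+0 ⟩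
        1# + 0# - 1#      ≈⟨ solve 0 (con (+ 1) :+ con (+ 0) :- con (+ 1) := con (+ 0)) ≈-refl ⟩
        0#                ∎)

    -- The hypothesis on `FAIL` reduces to the one on `p ^ c`, because failure of a minimum cut
    -- alone disconnects the graph.
    minCut<n⁻⁴ : p ^ c < exp (- fromℕ 4 * ℓ)
    minCut<n⁻⁴ = go smallness (proj₁ minCut)
      where
      go : (p ^ c < fromℕ n ^ʳ (- fromℕ 4) ⊎ FAIL G p < fromℕ n ^ʳ (- fromℕ 4)) →
           (∃ λ S → IsCut S × cutValue G S ≡ c) → p ^ c < exp (- fromℕ 4 * ℓ)
      go (inj₁ p^c<n⁻⁴)  _             = p^c<n⁻⁴
      go (inj₂ FAIL<n⁻⁴) (S , cut , eq) = begin-strict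
        p ^ c                   ≡⟨ ≡.cong (p ^_) eq ⟨
        p ^ cutValue G S        ≤⟨ cut≤FAIL G (<⇒≤ 0<p) (<⇒≤ p<1) cut ⟩
        FAIL G p                <⟨ FAIL<n⁻⁴ ⟩
        exp (- fromℕ 4 * ℓ)     ∎

    -- Comparing exponents of `n` in `p ^ c` and the inverse fourth power gives `(2 + δ)ℓ > 4ℓ`, and
    -- `ℓ` is positive.
    2≤δ : fromℕ 2 ≤ δ
    2≤δ = *-cancelˡ-≤ 0<ℓ (≤-by ((- fromℕ 4 * ℓ) - (- (fromℕ 2 + δ) * ℓ))
      (0≤-diff (<⇒≤ (exp-cancel-< (begin-strict
        exp (- (fromℕ 2 + δ) * ℓ)   ≈⟨ p^c≈ ⟨
        p ^ c                       <⟨ minCut<n⁻⁴ ⟩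
        exp (- fromℕ 4 * ℓ)         ∎))))
      (solve 2 (λ ℓ δ → ℓ :* con (+ 2) :+ (:- con (+ 4) :* ℓ :- (:- (con (+ 2) :+ δ) :* ℓ))
           := ℓ :* δ) ≈-refl ℓ δ))

    -- For `c = 0` the power is 1, which is not below the inverse fourth power of `n`. Thus the
    -- division by `c` in `t` is meaningful.
    positive : ∀ c → p ^ c < exp (- fromℕ 4 * ℓ) → 0# < fromℕ c
    positive (suc c) _ = 0<fromℕ c
    positive zero 1<n⁻⁴ = ⊥-elim (<⇒≱ 1<n⁻⁴ (begin
      exp (- fromℕ 4 * ℓ)   ≤⟨ exp-mono (≤-by (fromℕ 4 * ℓ) (*-nonNegative (0≤fromℕ 4) (<⇒≤ 0<ℓ))
                                 (solve 1 (λ ℓ → :- con (+ 4) :* ℓ :+ con (+ 4) :* ℓ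
                                      := con (+ 0)) ≈-refl ℓ)) ⟩
      exp 0#                ≈⟨ exp-0 ⟩
      1#                    ∎))

    0<c : 0# < fromℕ c
    0<c = positive c minCut<n⁻⁴

    t = ℓ / fromℕ c
    0≤t : 0# ≤ t
    0≤t = <⇒≤ (*-positive 0<ℓ (⁻¹-positive 0<c))
    tc≈ℓ : t * fromℕ c ≈ ℓ
    tc≈ℓ = /-cancelʳ ℓ 0<c

    p≈ : p ≈ exp (- ((fromℕ 2 + δ) * t))
    p≈ = ≈-trans (≈-sym (exp-ln 0<p)) (exp-cong (antisym
      (*-cancelˡ-≤ 0<c (≤-reflexive scaled)) (*-cancelˡ-≤ 0<c (≤-reflexive (≈-sym scaled)))))
      where
      -- A `c`-th root taken through logarithms: injectivity of `exp` turns the equation for `p ^ c`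
      -- into one for `c * ln p`, from which `c` cancels.
      scaled : fromℕ c * ln p ≈ fromℕ c * - ((fromℕ 2 + δ) * t)
      scaled = begin-equality
        fromℕ c * ln p                     ≈⟨ exp-injective (begin-equality
          exp (fromℕ c * ln p)               ≈⟨ exp-^ (ln p) c ⟨
          exp (ln p) ^ c                     ≈⟨ ^-congˡ c (exp-ln 0<p) ⟩
          p ^ c                              ≈⟨ p^c≈ ⟩
          exp (- (fromℕ 2 + δ) * ℓ)          ∎) ⟩
        - (fromℕ 2 + δ) * ℓ                ≈⟨ *-congˡ tc≈ℓ ⟨
        - (fromℕ 2 + δ) * (t * fromℕ c)
          ≈⟨ solve 3 (λ a t c → :- a :* (t :* c) := c :* :- (a :* t)) ≈-refl (fromℕ 2 + δ) t (fromℕ c) ⟩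
        fromℕ c * - ((fromℕ 2 + δ) * t)    ∎

    open Regime G c minCut (<⇒≤ 0<p) (<⇒≤ p<1) (<⇒≤ 0<ℓ) 0≤t 2≤δ expℓ≈n tc≈ℓ p≈

    ε-bound : ε n * K ≤ η
    ε-bound = begin
      ε n * K      ≤⟨ *-monoʳ-≤ (<⇒≤ 0<K) (proj₂ (proj₂ ε-small n
                        (ℕ.≤-trans (ℕ.≤-trans (ℕ.m≤n+m N₁ 2) (ℕ.m≤m+n _ N₂)) N≤n))) ⟩
      η / K * K    ≈⟨ /-cancelʳ η 0<K ⟩
      η            ∎

    γ-bound : fromℕ 3 * K * exp (- ℓ) ≤ γ * γ
    γ-bound = begin
      fromℕ 3 * K * exp (- ℓ)
        ≈⟨ *-congʳ (/-cancelʳ (fromℕ 3 * K) 0<γγ) ⟨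
      fromℕ 3 * K / (γ * γ) * (γ * γ) * exp (- ℓ)
        ≤⟨ *-monoʳ-≤ (0≤exp _) (*-monoʳ-≤ (<⇒≤ 0<γγ) (≤-trans (proj₂ n-large)
             (fromℕ-mono (ℕ.≤-trans (ℕ.m≤n+m N₂ (2 ℕ.+ N₁)) N≤n)))) ⟩
      fromℕ n * (γ * γ) * exp (- ℓ)
        ≈⟨ *-congʳ (*-congʳ expℓ≈n) ⟨
      exp ℓ * (γ * γ) * exp (- ℓ)
        ≈⟨ solve 3 (λ a b c → a :* b :* c := c :* a :* b) ≈-refl (exp ℓ) (γ * γ) (exp (- ℓ)) ⟩
      exp (- ℓ) * exp ℓ * (γ * γ)
        ≈⟨ ≈-trans (*-congʳ (exp-inverse ℓ)) (*-identityˡ _) ⟩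
      γ * γ ∎
      where
      0<γγ = *-positive 0<γ 0<γ
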